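{- Let $G$ be a finite group. Then $G$ is solvable if and only if its subgroup lattice $L(G)$ is comodernistic.
   Context: $L(G)$ is the lattice of all subgroups of $G$ ordered by inclusion. An element $m$ of a lattice $L$ is left-modular if $(x\vee m)\wedge y=x\vee(m\wedge y)$ for all $x<y$ in $L$. A lattice is comodernistic if every interval $[u,v]$ has a coatom that is left-modular as an element of the lattice $[u,v]$. -}

module Defs where

open import Data.Nat using (ℕ; suc)
open import Data.Fin using (Fin; zero; suc; inject₁; fromℕ)
open import Data.Fin.Subset using (Subset; _∈_; _⊆_; _∩_; ⊤; ⁅_⁆)
open import Data.Product using (Σ; _×_; ∃; proj₁)
open import Data.Sum using (_⊎_)
open import Relation.Binary.PropositionalEquality using (_≡_; _≢_)

record FinGroup (n : ℕ) : Set where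
  field
    _·_   : Fin n → Fin n → Fin n
    e     : Fin n
    inv   : Fin n → Fin n
    assoc : ∀ a b c → (a · b) · c ≡ a · (b · c)
    idˡ   : ∀ a → e · a ≡ a
    idʳ   : ∀ a → a · e ≡ a
    invˡ  : ∀ a → inv a · a ≡ e
    invʳ  : ∀ a → a · inv a ≡ e

module _ {n : ℕ} (G : FinGroup n) where
  open FinGroup G

  IsSubgroup : Subset n → Set
  IsSubgroup H = (e ∈ H)
               × (∀ {a b} → a ∈ H → b ∈ H → (a · b) ∈ H)
               × (∀ {a} → a ∈ H → inv a ∈ H)

  Sub : Set
  Sub = Σ (Subset n) IsSubgroup

  _≤L_ : Sub → Sub → Set
  A ≤L B = proj₁ A ⊆ proj₁ B

  _<L_ : Sub → Sub → Set
  A <L B = (proj₁ A ⊆ proj₁ B) × (proj₁ A ≢ proj₁ B)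

  IsJoin : Sub → Sub → Sub → Set
  IsJoin A B J = (A ≤L J) × (B ≤L J) × (∀ (K : Sub) → A ≤L K → B ≤L K → J ≤L K)

  IsMeet : Sub → Sub → Sub → Set
  IsMeet A B M = (M ≤L A) × (M ≤L B) × (∀ (K : Sub) → K ≤L A → K ≤L B → K ≤L M)

  InInterval : Sub → Sub → Sub → Set
  InInterval u v x = (u ≤L x) × (x ≤L v)

  -- m is left-modular in the interval [u,v]:
  -- (x ∨ m) ∧ y = x ∨ (m ∧ y) for all x < y in [u,v].
  -- Joins/meets in the interval [u,v] of L(G) coincide with those of L(G).
  LeftModularIn : Sub → Sub → Sub → Set
  LeftModularIn u v m =
    ∀ (x y : Sub) → InInterval u v x → InInterval u v y → x <L y →
    ∀ (xm : Sub) (lhs : Sub) (my : Sub) (rhs : Sub) →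
      IsJoin x m xm → IsMeet xm y lhs → IsMeet m y my → IsJoin x my rhs →
      proj₁ lhs ≡ proj₁ rhs

  CoatomOf : Sub → Sub → Sub → Set
  CoatomOf u v m = InInterval u v m × (m <L v)
                 × (∀ (k : Sub) → m ≤L k → k ≤L v →
                      (proj₁ k ≡ proj₁ m)
                      ⊎ (proj₁ k ≡ proj₁ v))

  Comodernistic : Set
  Comodernistic = ∀ (u v : Sub) → u <L v →
    Σ Sub (λ m → CoatomOf u v m × LeftModularIn u v m)

  NormalAbelianStep : Subset n → Subset n → Set
  NormalAbelianStep H K =
      (H ⊆ K)
    × (∀ {k h} → k ∈ K → h ∈ H → ((k · h) · inv k) ∈ H)
    × (∀ {a b} → a ∈ K → b ∈ K → (((a · b) · inv a) · inv b) ∈ H)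

  Solvable : Set
  Solvable = Σ ℕ λ k → Σ (Fin (suc k) → Subset n) λ S →
      (∀ i → IsSubgroup (S i))
    × (S zero ≡ ⁅ e ⁆)
    × (S (fromℕ k) ≡ ⊤)
    × (∀ (i : Fin k) → NormalAbelianStep (S (inject₁ i)) (S (suc i)))

{-# OPTIONS --safe #-}
module Submission where

open import Defs
open import Algebra.Bundles using (AbelianGroup; CommutativeMonoid)
import Algebra.Properties.CommutativeMonoid.Sum as Sum
import Algebra.Solver.CommutativeMonoid as CMSolver
open import Data.Bool using (Bool; true; false; not)
open import Data.Fin as Fin using (Fin; zero; suc; toℕ; fromℕ<)
import Data.Fin.Permutation as Perm
import Data.Fin.Properties as Finₚ
open import Data.Fin.Properties using (all?; any?)
open import Data.Fin.Subset using (Subset; _∈_; _∉_; _⊆_; _⊂_; _⊃_; ⊤; ⁅_⁆)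
open import Data.Fin.Subset.Induction using (⊂-wellFounded; ⊃-wellFounded)
open import Data.Fin.Subset.Properties using (_∈?_; _⊆?_; _⊂?_; anySubset?; ⊆-antisym; ⊆-refl; ⊆-trans; ∈⊤; x∈⁅x⁆; x∈⁅y⁆⇒x≡y)
open import Data.List using (List; []; _∷_; allFin; filter; length; lookup)
import Data.List.Membership.Propositional as Mem
open import Data.List.Membership.Propositional.Properties using (∈-filter⁺; ∈-filter⁻; ∈-allFin; ∈-lookup)
open import Data.List.Relation.Unary.All as All using (All; []; _∷_)
open import Data.List.Relation.Unary.All.Properties using (all-filter)
open import Data.List.Relation.Unary.AllPairs using ([]; _∷_)
open import Data.List.Relation.Unary.Any using (here; there; index)
open import Data.List.Relation.Unary.Any.Properties using (lookup-index)
open import Data.List.Relation.Unary.Unique.Propositional using (Unique)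
import Data.List.Relation.Unary.Unique.Propositional.Properties as Uniqueₚ
open import Data.Nat using (ℕ; zero; suc; _+_; _*_; _∸_; _≤_; _<_; z≤n; s≤s; >-nonZero)
open import Data.Nat.Divisibility as Div using (divides; ∣⇒≤)
open import Data.Nat.DivMod using (_%_; _/_; m≡m%n+[m/n]*n; m%n<n)
open import Data.Nat.GCD using (module Bézout; module GCD)
open import Data.Nat.Induction using (<-wellFounded)
import Data.Nat.Properties as ℕₚ
open import Data.Product using (Σ; ∃; _×_; _,_; proj₁; proj₂)
open import Data.Sum using (_⊎_; inj₁; inj₂; [_,_]′)
open import Data.Unit as Unit using (tt)
open import Data.Vec as Vec using (Vec)
open import Data.Vec.Properties using (lookup∘tabulate; lookup⇒[]=; []=⇒lookup)
open import Function using (_∘_; mk⇔)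
open import Function.Bundles using (_⇔_)
open import Induction.WellFounded using (Acc; acc)
open import Level using (0ℓ)
open import Relation.Binary using (Rel; IsDecEquivalence; tri<; tri≈; tri>)
open import Relation.Binary.PropositionalEquality using (_≡_; _≢_; refl; sym; trans; cong; cong₂; subst; module ≡-Reasoning) renaming (setoid to ≡-setoid)
import Relation.Binary.Reflection as Reflection
open import Relation.Nullary using (¬_; Dec; yes; no; does; contradiction)
open import Relation.Nullary.Decidable using (_×-dec_; _→-dec_; ¬?; map′; dec-true; decidable-stable)
open import Relation.Unary using (Pred; Decidable)

-- Solvable ⇒ comodernistic.  For u < v choose i with v = u v⁽ⁱ⁾ ≠ u v⁽ⁱ⁺¹⁾ (derived series of v) and a maximal
-- subgroup m of v above u v⁽ⁱ⁺¹⁾.  Then K = v⁽ⁱ⁾ ∩ m is normal in v, and every x ≥ u not contained in m satisfies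
-- x K = v; hence y = x (K ∩ y) for every y ≥ x, which is left-modularity.
--
-- Comodernistic ⇒ solvable.  Let N be a maximal proper normal subgroup of K; it suffices to show that the simple
-- group H = K/N is abelian.  A left-modular coatom of [N,K] gives a proper subgroup M of H such that M ∩ Y is Y or
-- maximal in Y for every subgroup Y; the conjugates of M have the same property and intersect trivially.  Let q be
-- the least order of a nontrivial element, x ∉ M of order q, and Q ∋ x a maximal elementary abelian q-subgroup.
-- For every conjugate L of M, the normalizer C of Q permutes the q − 1 nontrivial cosets of Q ∩ L in Q, and since
-- no element has order less than q it fixes them; so [C,Q] lies in all L and C centralizes Q.  Now C ∩ M is normal
-- in C with C/(C ∩ M) abelian of exponent q, and x ∉ C ∩ M.  In the transfer V : H → C/(C ∩ M), the cosets
-- of C moved by Q cancel, and C itself is the only coset fixed by Q, so V(x) = x ≠ 1.  By simplicity V is injective,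
-- so H is abelian.

-- Decidable subsets, extremal elements and equivalence classes in finite sets.

opaque
  ⟪_⟫ : ∀ {n} {P : Pred (Fin n) 0ℓ} → Decidable P → Subset n
  ⟪ P? ⟫ = Vec.tabulate (λ x → does (P? x))

  ∈⟪⟫⁺ : ∀ {n} {P : Pred (Fin n) 0ℓ} (P? : Decidable P) {x} → P x → x ∈ ⟪ P? ⟫
  ∈⟪⟫⁺ P? {x} p = lookup⇒[]= x _ (trans (lookup∘tabulate _ x) (dec-true (P? x) p))

  ∈⟪⟫⁻ : ∀ {n} {P : Pred (Fin n) 0ℓ} (P? : Decidable P) {x} → x ∈ ⟪ P? ⟫ → P x
  ∈⟪⟫⁻ P? {x} x∈ with P? x | trans (sym (lookup∘tabulate (λ x → does (P? x)) x)) ([]=⇒lookup x∈)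
  ... | yes p | _ = p
  ... | no _  | ()

  ⊈⇒∃∉ : ∀ {n} {S T : Subset n} → ¬ (S ⊆ T) → ∃ λ x → x ∈ S × x ∉ T
  ⊈⇒∃∉ {S = S} {T} S⊈T with any? (λ x → x ∈? S ×-dec ¬? (x ∈? T))
  ... | yes w = w
  ... | no ∄ = contradiction (λ {x} x∈S → decidable-stable (x ∈? T) (λ x∉T → ∄ (x , x∈S , x∉T))) S⊈T

  -- Induction on strict inclusion upwards: a decidable search either finds a larger set with `P` or
  -- certifies `S`. It supplies the maximal subgroups, the maximal proper normal subgroups and the
  -- maximal elementary abelian subgroups used later.
  maximal : ∀ {n} {P : Pred (Subset n) 0ℓ} → Decidable P → ∀ S → P S →
            ∃ λ T → P T × S ⊆ T × (∀ U → P U → T ⊆ U → U ⊆ T)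
  maximal {n} {P} P? S = go S (⊃-wellFounded S)
    where
    go : ∀ S → Acc _⊃_ S → P S → ∃ λ T → P T × S ⊆ T × (∀ U → P U → T ⊆ U → U ⊆ T)
    go S (acc rec) pS with anySubset? (λ U → P? U ×-dec (S ⊂? U))
    ... | yes (U , pU , S⊂U) =
          let T , pT , U⊆T , max = go U (rec S⊂U) pU
          in T , pT , ⊆-trans (proj₁ S⊂U) U⊆T , max
    ... | no ∄ = S , pS , ⊆-refl , λ U pU S⊆U → decidable-stable (U ⊆? S) λ U⊈S →
          ∄ (U , pU , S⊆U , ⊈⇒∃∉ U⊈S)

  least : ∀ {P : Pred ℕ 0ℓ} → Decidable P → ∀ k → P k → ∃ λ m → P m × (∀ j → j < m → ¬ P j)
  least {P} P? k = go k (<-wellFounded k)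
    where
    go : ∀ k → Acc _<_ k → P k → ∃ λ m → P m × (∀ j → j < m → ¬ P j)
    go k (acc rec) pk with ℕₚ.anyUpTo? P? k
    ... | yes (j , j<k , pj) = go j (rec j<k) pj
    ... | no ∄ = k , pk , λ j j<k pj → ∄ (j , j<k , pj)

lookup-injective : ∀ {A : Set} {xs : List A} → Unique xs → ∀ i j → lookup xs i ≡ lookup xs j → i ≡ j
lookup-injective (_ ∷ _) zero zero _ = refl
lookup-injective (x≢ ∷ _) zero (suc j) eq = contradiction eq (All.lookup x≢ (∈-lookup j))
lookup-injective (x≢ ∷ _) (suc i) zero eq = contradiction (sym eq) (All.lookup x≢ (∈-lookup i))
lookup-injective (_ ∷ u) (suc i) (suc j) eq = cong suc (lookup-injective u i j eq)

-- The classes of ~ that meet P, numbered by Fin size, with chosen representatives.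
record Classes {n} (P : Pred (Fin n) 0ℓ) (_~_ : Rel (Fin n) 0ℓ) : Set where
  field
    size       : ℕ
    rep        : Fin size → Fin n
    rep∈       : ∀ i → P (rep i)
    cls        : ∀ x → P x → Fin size
    rep-cls    : ∀ x p → rep (cls x p) ~ x
    rep-unique : ∀ i j → rep i ~ rep j → i ≡ j

opaque
  classes : ∀ {n} {P : Pred (Fin n) 0ℓ} {_~_ : Rel (Fin n) 0ℓ} →
            Decidable P → IsDecEquivalence _~_ → Classes P _~_
  classes {n} {P} {_~_} P? ~-equiv = record
    { size = length reps
    ; rep = lookup reps
    ; rep∈ = λ i → proj₁ (canonical i)
    ; cls = λ x p → index (listed x p)
    ; rep-cls = λ x p → subst (_~ x) (lookup-index (listed x p)) (proj₂ (proj₂ (canonicalRep x p)))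
    ; rep-unique = λ i j eq → lookup-injective (Uniqueₚ.filter⁺ canonical? (Uniqueₚ.allFin⁺ n)) i j
        (canonical-unique (canonical i) (canonical j) eq)
    }
    where
    open IsDecEquivalence ~-equiv renaming (refl to ~-refl; sym to ~-sym; trans to ~-trans)

    -- Choosing the member of least index singles out one representative per class, so the
    -- representatives are a filter of `allFin n` and inherit its freedom from repetitions.
    Canonical : Pred (Fin n) 0ℓ
    Canonical x = P x × (∀ y → P y → y ~ x → toℕ x ≤ toℕ y)

    canonical? : Decidable Canonical
    canonical? x = P? x ×-dec all? λ y → P? y →-dec ((y ≟ x) →-dec (toℕ x ℕₚ.≤? toℕ y))

    reps : List (Fin n)
    reps = filter canonical? (allFin n)

    canonical : ∀ i → Canonical (lookup reps i)
    canonical i = proj₂ (∈-filter⁻ canonical? {xs = allFin n} (∈-lookup i))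

    canonicalRep : ∀ x → P x → ∃ λ y → Canonical y × y ~ x
    canonicalRep x p with
      least (λ k → any? λ y → (toℕ y ℕₚ.≟ k) ×-dec P? y ×-dec (y ≟ x)) (toℕ x) (x , refl , p , ~-refl)
    ... | k , (y , refl , py , y~x) , min = y , (py , λ z pz z~y →
          ℕₚ.≮⇒≥ λ z<y → min (toℕ z) z<y (z , refl , pz , ~-trans z~y y~x)) , y~x

    listed : ∀ x p → proj₁ (canonicalRep x p) Mem.∈ reps
    listed x p = ∈-filter⁺ canonical? (∈-allFin _) (proj₁ (proj₂ (canonicalRep x p)))

    canonical-unique : ∀ {x y} → Canonical x → Canonical y → x ~ y → x ≡ y
    canonical-unique (px , minx) (py , miny) x~y =
      Finₚ.toℕ-injective (ℕₚ.≤-antisym (minx _ py (~-sym x~y)) (miny _ px x~y))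

-- Iterates of a periodic map and their orbits.

iter : ∀ {A : Set} → (A → A) → ℕ → A → A
iter σ zero    x = x
iter σ (suc k) x = σ (iter σ k x)

iter-+ : ∀ {A : Set} (σ : A → A) a b x → iter σ (a + b) x ≡ iter σ a (iter σ b x)
iter-+ σ zero    b x = refl
iter-+ σ (suc a) b x = cong σ (iter-+ σ a b x)

iter-fixed : ∀ {A : Set} (σ : A → A) k {x} → σ x ≡ x → iter σ k x ≡ x
iter-fixed σ zero    eq = refl
iter-fixed σ (suc k) eq = trans (cong σ (iter-fixed σ k eq)) eq

iter-* : ∀ {A : Set} (σ : A → A) a b {x} → iter σ b x ≡ x → iter σ (a * b) x ≡ x
iter-* σ zero    b     eq = refl
iter-* σ (suc a) b {x} eq = trans (iter-+ σ b (a * b) x) (trans (cong (iter σ b) (iter-* σ a b eq)) eq)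

-- `free` stands in for the primality of `suc p`: together with `period` it forces every orbit to
-- have either one point or exactly `suc p` points.
module Orbits {n p : ℕ} (σ : Fin n → Fin n)
  (period : ∀ i → iter σ (suc p) i ≡ i)
  (free : ∀ i d → 0 < d → d < suc p → iter σ d i ≡ i → σ i ≡ i) where

  -- Bounding the exponent makes the relation decidable; `~-intro` reduces arbitrary exponents
  -- modulo the period.
  _~_ : Rel (Fin n) 0ℓ
  i ~ j = ∃ λ (k : Fin (suc p)) → iter σ (toℕ k) i ≡ j

  ~-intro : ∀ k {i j} → iter σ k i ≡ j → i ~ j
  ~-intro k {i} {j} eq = fromℕ< (m%n<n k (suc p)) , (begin
    iter σ (toℕ (fromℕ< (m%n<n k (suc p)))) i   ≡⟨ cong (λ r → iter σ r i) (Finₚ.toℕ-fromℕ< (m%n<n k (suc p))) ⟩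
    iter σ r i                                  ≡⟨ cong (iter σ r) (iter-* σ (k / suc p) (suc p) (period i)) ⟨
    iter σ r (iter σ (k / suc p * suc p) i)     ≡⟨ iter-+ σ r _ i ⟨
    iter σ (r + k / suc p * suc p) i            ≡⟨ cong (λ m → iter σ m i) (m≡m%n+[m/n]*n k (suc p)) ⟨
    iter σ k i                                  ≡⟨ eq ⟩
    j ∎)
    where
    open ≡-Reasoning
    r = k % suc p

  return : ∀ k {i} → k ≤ suc p → iter σ (suc p ∸ k) (iter σ k i) ≡ i
  return k {i} k≤ = trans (sym (iter-+ σ (suc p ∸ k) k i))
    (trans (cong (λ m → iter σ m i) (ℕₚ.m∸n+n≡m k≤)) (period i))

  ~-sym : ∀ {i j} → i ~ j → j ~ i
  ~-sym (k , refl) = ~-intro (suc p ∸ toℕ k) (return (toℕ k) (ℕₚ.<⇒≤ (Finₚ.toℕ<n k)))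

  ~-isDecEquivalence : IsDecEquivalence _~_
  ~-isDecEquivalence = record
    { isEquivalence = record
      { refl = zero , refl
      ; sym = ~-sym
      ; trans = λ { {i} (k , refl) (l , refl) → ~-intro (toℕ l + toℕ k) (iter-+ σ (toℕ l) (toℕ k) i) }
      }
    ; _≟_ = λ i j → any? λ k → iter σ (toℕ k) i Finₚ.≟ j
    }

  fixed-~ : ∀ {i j} → i ~ j → σ i ≡ i → σ j ≡ j
  fixed-~ (k , refl) eq = trans (cong σ (iter-fixed σ (toℕ k) eq)) (trans eq (sym (iter-fixed σ (toℕ k) eq)))

  private
    -- The point `iter σ a i` is fixed by `iter σ (b ∸ a)`, so `free` makes it a fixed point of `σ`,
    -- and being fixed is constant on orbits.
    injective-< : ∀ {i} a b → a < b → b < suc p → iter σ a i ≡ iter σ b i → σ i ≡ i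
    injective-< {i} a b a<b b<q eq = fixed-~ (~-sym (~-intro a refl))
      (free (iter σ a i) (b ∸ a) (ℕₚ.m<n⇒0<n∸m a<b) (ℕₚ.≤-<-trans (ℕₚ.m∸n≤m b a) b<q)
        (trans (sym (iter-+ σ (b ∸ a) a i))
          (trans (cong (λ m → iter σ m i) (ℕₚ.m∸n+n≡m (ℕₚ.<⇒≤ a<b))) (sym eq))))

  iter-injective : ∀ {i} → σ i ≢ i → ∀ (k l : Fin (suc p)) → iter σ (toℕ k) i ≡ iter σ (toℕ l) i → k ≡ l
  iter-injective {i} moved k l eq with ℕₚ.<-cmp (toℕ k) (toℕ l)
  ... | tri< k<l _ _ = contradiction (injective-< _ _ k<l (Finₚ.toℕ<n l) eq) moved
  ... | tri≈ _ k≡l _ = Finₚ.toℕ-injective k≡l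
  ... | tri> _ _ l<k = contradiction (injective-< _ _ l<k (Finₚ.toℕ<n k) (sym eq)) moved

-- Finite sums in a commutative monoid and their restriction to fixed points.

module Summation (M : CommutativeMonoid 0ℓ 0ℓ) where
  open CommutativeMonoid M renaming (refl to ≈-refl; sym to ≈-sym; trans to ≈-trans; reflexive to ≈-reflexive)
  open Sum M
  open import Relation.Binary.Reasoning.Setoid setoid

  sum-zero : ∀ {n} {f : Fin n → Carrier} → (∀ i → f i ≈ ε) → sum f ≈ ε
  sum-zero {n} eq = ≈-trans (sum-cong-≋ eq) (sum-replicate-zero n)

  sum-single : ∀ {n} {f : Fin n → Carrier} i → (∀ j → j ≢ i → f j ≈ ε) → sum f ≈ f i
  sum-single {suc n} {f} i eq = begin
    sum f                              ≈⟨ sum-remove {i = i} f ⟩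
    f i ∙ sum (λ j → f (Fin.punchIn i j)) ≈⟨ ∙-congˡ (sum-zero λ j → eq _ (Finₚ.punchInᵢ≢i i j)) ⟩
    f i ∙ ε                            ≈⟨ identityʳ _ ⟩
    f i                                ∎

  when : ∀ {P : Set} → Dec P → Carrier → Carrier
  when (yes _) a = a
  when (no _)  a = ε

  when-yes : ∀ {P : Set} (d : Dec P) {a} → P → when d a ≈ a
  when-yes (yes _) p = ≈-refl
  when-yes (no ¬p) p = contradiction p ¬p

  when-no : ∀ {P : Set} (d : Dec P) {a} → ¬ P → when d a ≈ ε
  when-no (yes p) ¬p = contradiction p ¬p
  when-no (no _)  ¬p = ≈-refl

  when-ε : ∀ {P : Set} (d : Dec P) {a} → a ≈ ε → when d a ≈ ε
  when-ε (yes _) eq = eq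
  when-ε (no _)  eq = ≈-refl

  when-cong : ∀ {P Q : Set} (d : Dec P) (d′ : Dec Q) {a b} → (P → Q) → (Q → P) → (P → a ≈ b) → when d a ≈ when d′ b
  when-cong (yes p) d′      P→Q Q→P eq = ≈-trans (eq p) (≈-sym (when-yes d′ (P→Q p)))
  when-cong (no ¬p) d′      P→Q Q→P eq = ≈-sym (when-no d′ (¬p ∘ Q→P))

  -- The moved points split into orbits of exactly suc p points each, and each orbit contributes ε.
  sum-over-fixed-points : ∀ {n p} (σ : Fin n → Fin n)
    (period : ∀ i → iter σ (suc p) i ≡ i)
    (free : ∀ i d → 0 < d → d < suc p → iter σ d i ≡ i → σ i ≡ i)
    (f : Fin n → Carrier)
    (orbit-sum : ∀ i → σ i ≢ i → ∑[ k < suc p ] f (iter σ (toℕ k) i) ≈ ε) →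
    sum f ≈ ∑[ i < n ] when (σ i Finₚ.≟ i) (f i)
  sum-over-fixed-points {n} {p} σ period free f orbit-sum = begin
    sum f                                                             ≈⟨ sum-cong-≋ split ⟩
    ∑[ i < n ] (fixed i ∙ (∑[ c < size ] ∑[ k < suc p ] at i c k))    ≈⟨ ∑-distrib-+ fixed _ ⟩
    sum fixed ∙ (∑[ i < n ] ∑[ c < size ] ∑[ k < suc p ] at i c k)    ≈⟨ ∙-congˡ moved≈ε ⟩
    sum fixed ∙ ε                                                     ≈⟨ identityʳ _ ⟩
    sum fixed                                                         ∎
    where
    open Orbits σ period free
    open Classes (classes (λ i → ¬? (σ i Finₚ.≟ i)) ~-isDecEquivalence)

    fixed : Fin n → Carrier
    fixed i = when (σ i Finₚ.≟ i) (f i)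

    point : Fin size → Fin (suc p) → Fin n
    point c k = iter σ (toℕ k) (rep c)

    at : Fin n → Fin size → Fin (suc p) → Carrier
    at i c k = when (point c k Finₚ.≟ i) (f i)

    at-no : ∀ {i} c k → point c k ≢ i → at i c k ≈ ε
    at-no {i} c k = when-no (point c k Finₚ.≟ i)

    sum-at : ∀ c k → ∑[ i < n ] at i c k ≈ f (point c k)
    sum-at c k = ≈-trans (sum-single (point c k) λ j j≢ → at-no c k (j≢ ∘ sym))
      (when-yes (point c k Finₚ.≟ point c k) refl)

    -- A moved `i` equals `point c k` for exactly one pair, given by its class and its position in
    -- the orbit; a fixed `i` is no such point. The double sum therefore picks out `f i` precisely
    -- when `i` is moved.
    split : ∀ i → f i ≈ fixed i ∙ (∑[ c < size ] ∑[ k < suc p ] at i c k)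
    split i with σ i Finₚ.≟ i
    ... | yes σi≡i = ≈-sym (≈-trans (∙-congˡ (sum-zero λ c → sum-zero λ k → at-no c k
                      λ eq → rep∈ c (fixed-~ (~-sym (k , eq)) σi≡i))) (identityʳ _))
    ... | no σi≢i = ≈-sym (begin
      ε ∙ (∑[ c < size ] ∑[ k < suc p ] at i c k) ≈⟨ identityˡ _ ⟩
      ∑[ c < size ] ∑[ k < suc p ] at i c k       ≈⟨ sum-single c₀ (λ c c≢c₀ → sum-zero λ k →
                                                       at-no c k λ eq → c≢c₀ (rep-unique c c₀
                                                         (~-trans (k , eq) (~-sym (rep-cls i σi≢i))))) ⟩
      ∑[ k < suc p ] at i c₀ k                    ≈⟨ sum-single k₀ (λ k k≢k₀ → at-no c₀ k
                                                       λ eq → k≢k₀ (iter-injective (rep∈ c₀) k k₀ (trans eq (sym eq₀)))) ⟩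
      at i c₀ k₀                                  ≈⟨ when-yes (point c₀ k₀ Finₚ.≟ i) eq₀ ⟩
      f i                                         ∎)
      where
      open IsDecEquivalence ~-isDecEquivalence using () renaming (trans to ~-trans)
      c₀ = cls i σi≢i
      k₀ = proj₁ (rep-cls i σi≢i)
      eq₀ = proj₂ (rep-cls i σi≢i)

    -- Bringing the sum over `i` inside collapses the indicator `at` and leaves one orbit sum per
    -- class.
    moved≈ε : ∑[ i < n ] ∑[ c < size ] ∑[ k < suc p ] at i c k ≈ ε
    moved≈ε = begin
      ∑[ i < n ] ∑[ c < size ] ∑[ k < suc p ] at i c k ≈⟨ ∑-comm (λ i c → ∑[ k < suc p ] at i c k) ⟩
      ∑[ c < size ] ∑[ i < n ] ∑[ k < suc p ] at i c k ≈⟨ sum-cong-≋ (λ c → ∑-comm (λ i k → at i c k)) ⟩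
      ∑[ c < size ] ∑[ k < suc p ] ∑[ i < n ] at i c k ≈⟨ sum-cong-≋ (λ c → sum-cong-≋ (sum-at c)) ⟩
      ∑[ c < size ] ∑[ k < suc p ] f (point c k)       ≈⟨ sum-zero (λ c → orbit-sum (rep c) (rep∈ c)) ⟩
      ε ∎

-- Free group words, for a solver of identities valid in all groups.

infixl 7 _⊗_
infix 8 _⁻¹

data Expr (k : ℕ) : Set where
  var : Fin k → Expr k
  _⊗_ : Expr k → Expr k → Expr k
  _⁻¹ : Expr k → Expr k
  one : Expr k

-- The letter `true` marks a generator and `false` its inverse.
Word : ℕ → Set
Word k = List (Bool × Fin k)

push : ∀ {k} → Bool → Fin k → Word k → Word k
push b     i []              = (b , i) ∷ []
push true  i ((false , j) ∷ w) with i Finₚ.≟ j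
... | yes _ = w
... | no _  = (true , i) ∷ (false , j) ∷ w
push false i ((true , j) ∷ w) with i Finₚ.≟ j
... | yes _ = w
... | no _  = (false , i) ∷ (true , j) ∷ w
push true  i ((true , j) ∷ w)  = (true , i) ∷ (true , j) ∷ w
push false i ((false , j) ∷ w) = (false , i) ∷ (false , j) ∷ w

-- The boolean says whether the expression or its inverse is meant. Since `push` cancels against the
-- head of the accumulated word, starting from the empty word yields the reduced word of the free
-- group, and two expressions equal in all groups normalize identically.
reduce : ∀ {k} → Bool → Expr k → Word k → Word k
reduce b     (var i) w = push b i w
reduce true  (x ⊗ y) w = reduce true x (reduce true y w)
reduce false (x ⊗ y) w = reduce false y (reduce false x w)
reduce b     (x ⁻¹)  w = reduce (not b) x w
reduce b     one     w = w

-- Elementary theory of a finite group: powers, orders, subgroups and cosets.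

module GroupTheory {n : ℕ} (G : FinGroup n) where
  open FinGroup G public
  open ≡-Reasoning

  cancelˡ : ∀ a b → inv a · (a · b) ≡ b
  cancelˡ a b = trans (sym (assoc _ _ _)) (trans (cong (_· b) (invˡ a)) (idˡ b))

  cancelˡ′ : ∀ a b → a · (inv a · b) ≡ b
  cancelˡ′ a b = trans (sym (assoc _ _ _)) (trans (cong (_· b) (invʳ a)) (idˡ b))

  inv-unique : ∀ a b → a · b ≡ e → b ≡ inv a
  inv-unique a b ab≡e = trans (sym (cancelˡ a b)) (trans (cong (inv a ·_) ab≡e) (idʳ _))

  inv-· : ∀ a b → inv (a · b) ≡ inv b · inv a
  inv-· a b = sym (inv-unique _ _ (begin
    (a · b) · (inv b · inv a) ≡⟨ assoc _ _ _ ⟩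
    a · (b · (inv b · inv a)) ≡⟨ cong (a ·_) (cancelˡ′ b _) ⟩
    a · inv a                 ≡⟨ invʳ a ⟩
    e                         ∎))

  inv-inv : ∀ a → inv (inv a) ≡ a
  inv-inv a = sym (inv-unique _ _ (invˡ a))

  inv-e : inv e ≡ e
  inv-e = sym (inv-unique _ _ (idˡ e))

  ⟦_⟧ : ∀ {k} → Expr k → Vec (Fin n) k → Fin n
  ⟦ var i ⟧ ρ = Vec.lookup ρ i
  ⟦ x ⊗ y ⟧ ρ = ⟦ x ⟧ ρ · ⟦ y ⟧ ρ
  ⟦ x ⁻¹ ⟧  ρ = inv (⟦ x ⟧ ρ)
  ⟦ one ⟧   ρ = e

  private
    signed : Bool → Fin n → Fin n
    signed true  a = a
    signed false a = inv a

    ⟦_⟧ʷ : ∀ {k} → Word k → Vec (Fin n) k → Fin n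
    ⟦ [] ⟧ʷ          ρ = e
    ⟦ (b , i) ∷ w ⟧ʷ ρ = signed b (Vec.lookup ρ i) · ⟦ w ⟧ʷ ρ

    ⟦_⇓⟧ : ∀ {k} → Expr k → Vec (Fin n) k → Fin n
    ⟦ x ⇓⟧ = ⟦ reduce true x [] ⟧ʷ

    push-correct : ∀ {k} b (i : Fin k) w ρ → ⟦ push b i w ⟧ʷ ρ ≡ signed b (Vec.lookup ρ i) · ⟦ w ⟧ʷ ρ
    push-correct b     i []                ρ = refl
    push-correct true  i ((false , j) ∷ w) ρ with i Finₚ.≟ j
    ... | yes refl = sym (cancelˡ′ _ _)
    ... | no _     = refl
    push-correct false i ((true , j) ∷ w)  ρ with i Finₚ.≟ j
    ... | yes refl = sym (cancelˡ _ _)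
    ... | no _     = refl
    push-correct true  i ((true , j) ∷ w)  ρ = refl
    push-correct false i ((false , j) ∷ w) ρ = refl

    signed-not : ∀ b a → signed (not b) a ≡ signed b (inv a)
    signed-not true  a = refl
    signed-not false a = sym (inv-inv a)

    signed-e : ∀ b → signed b e ≡ e
    signed-e true  = refl
    signed-e false = inv-e

    reduce-correct : ∀ {k} b (x : Expr k) w ρ → ⟦ reduce b x w ⟧ʷ ρ ≡ signed b (⟦ x ⟧ ρ) · ⟦ w ⟧ʷ ρ
    reduce-correct b     (var i) w ρ = push-correct b i w ρ
    reduce-correct true  (x ⊗ y) w ρ = begin
      ⟦ reduce true x (reduce true y w) ⟧ʷ ρ ≡⟨ reduce-correct true x _ ρ ⟩
      ⟦ x ⟧ ρ · ⟦ reduce true y w ⟧ʷ ρ       ≡⟨ cong (⟦ x ⟧ ρ ·_) (reduce-correct true y w ρ) ⟩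
      ⟦ x ⟧ ρ · (⟦ y ⟧ ρ · ⟦ w ⟧ʷ ρ)         ≡⟨ assoc _ _ _ ⟨
      (⟦ x ⟧ ρ · ⟦ y ⟧ ρ) · ⟦ w ⟧ʷ ρ         ∎
    reduce-correct false (x ⊗ y) w ρ = begin
      ⟦ reduce false y (reduce false x w) ⟧ʷ ρ         ≡⟨ reduce-correct false y _ ρ ⟩
      inv (⟦ y ⟧ ρ) · ⟦ reduce false x w ⟧ʷ ρ          ≡⟨ cong (inv (⟦ y ⟧ ρ) ·_) (reduce-correct false x w ρ) ⟩
      inv (⟦ y ⟧ ρ) · (inv (⟦ x ⟧ ρ) · ⟦ w ⟧ʷ ρ)       ≡⟨ assoc _ _ _ ⟨
      (inv (⟦ y ⟧ ρ) · inv (⟦ x ⟧ ρ)) · ⟦ w ⟧ʷ ρ       ≡⟨ cong (_· ⟦ w ⟧ʷ ρ) (inv-· _ _) ⟨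
      inv (⟦ x ⟧ ρ · ⟦ y ⟧ ρ) · ⟦ w ⟧ʷ ρ               ∎
    reduce-correct b     (x ⁻¹)  w ρ = trans (reduce-correct (not b) x w ρ) (cong (_· ⟦ w ⟧ʷ ρ) (signed-not b _))
    reduce-correct b     one     w ρ = sym (trans (cong (_· ⟦ w ⟧ʷ ρ) (signed-e b)) (idˡ _))

    correct : ∀ {k} (x : Expr k) ρ → ⟦ x ⇓⟧ ρ ≡ ⟦ x ⟧ ρ
    correct x ρ = trans (reduce-correct true x [] ρ) (idʳ _)

  open Reflection (≡-setoid (Fin n)) var ⟦_⟧ ⟦_⇓⟧ correct public using (solve; _⊜_)

  conj : Fin n → Fin n → Fin n
  conj g a = (g · a) · inv g

  comm : Fin n → Fin n → Fin n
  comm a b = ((a · b) · inv a) · inv b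

  conjᵉ commᵉ : ∀ {k} → Expr k → Expr k → Expr k
  conjᵉ g a = (g ⊗ a) ⊗ g ⁻¹
  commᵉ a b = ((a ⊗ b) ⊗ a ⁻¹) ⊗ b ⁻¹

  comm≡e⇒commute : ∀ a b → comm a b ≡ e → a · b ≡ b · a
  comm≡e⇒commute a b eq = begin
    a · b                 ≡⟨ solve 2 (λ a b → a ⊗ b ⊜ commᵉ a b ⊗ (b ⊗ a)) refl a b ⟩
    comm a b · (b · a)    ≡⟨ cong (_· (b · a)) eq ⟩
    e · (b · a)           ≡⟨ idˡ _ ⟩
    b · a                 ∎

  commute⇒conj≡ : ∀ a b → a · b ≡ b · a → conj a b ≡ b
  commute⇒conj≡ a b eq = trans (cong (_· inv a) eq) (solve 2 (λ a b → (b ⊗ a) ⊗ a ⁻¹ ⊜ b) refl a b)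

  pow : Fin n → ℕ → Fin n
  pow a zero    = e
  pow a (suc k) = a · pow a k

  pow-+ : ∀ a i j → pow a (i + j) ≡ pow a i · pow a j
  pow-+ a zero    j = sym (idˡ _)
  pow-+ a (suc i) j = trans (cong (a ·_) (pow-+ a i j)) (sym (assoc _ _ _))

  pow-* : ∀ a i j → pow a (i * j) ≡ pow (pow a j) i
  pow-* a zero    j = refl
  pow-* a (suc i) j = trans (pow-+ a j (i * j)) (cong (pow a j ·_) (pow-* a i j))

  pow-e : ∀ k → pow e k ≡ e
  pow-e zero    = refl
  pow-e (suc k) = trans (idˡ _) (pow-e k)

  pow-*≡e : ∀ {a} i {j} → pow a j ≡ e → pow a (i * j) ≡ e
  pow-*≡e {a} i {j} eq = trans (pow-* a i j) (trans (cong (λ b → pow b i) eq) (pow-e i))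

  pow-commute : ∀ {a b} k → a · b ≡ b · a → pow a k · b ≡ b · pow a k
  pow-commute {a} {b} zero    eq = trans (idˡ b) (sym (idʳ b))
  pow-commute {a} {b} (suc k) eq = begin
    (a · pow a k) · b ≡⟨ assoc _ _ _ ⟩
    a · (pow a k · b) ≡⟨ cong (a ·_) (pow-commute k eq) ⟩
    a · (b · pow a k) ≡⟨ assoc _ _ _ ⟨
    (a · b) · pow a k ≡⟨ cong (_· pow a k) eq ⟩
    (b · a) · pow a k ≡⟨ assoc _ _ _ ⟩
    b · (a · pow a k) ∎

  pow-· : ∀ {a b} k → a · b ≡ b · a → pow (a · b) k ≡ pow a k · pow b k
  pow-· {a} {b} zero    eq = sym (idˡ e)
  pow-· {a} {b} (suc k) eq = begin
    (a · b) · pow (a · b) k         ≡⟨ cong ((a · b) ·_) (pow-· k eq) ⟩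
    (a · b) · (pow a k · pow b k)   ≡⟨ solve 4 (λ a b x y → (a ⊗ b) ⊗ (x ⊗ y) ⊜ a ⊗ ((b ⊗ x) ⊗ y)) refl a b _ _ ⟩
    a · ((b · pow a k) · pow b k)   ≡⟨ cong (λ z → a · (z · pow b k)) (pow-commute k eq) ⟨
    a · ((pow a k · b) · pow b k)   ≡⟨ solve 4 (λ a b x y → a ⊗ ((x ⊗ b) ⊗ y) ⊜ (a ⊗ x) ⊗ (b ⊗ y)) refl a b _ _ ⟩
    (a · pow a k) · (b · pow b k)   ∎

  conj-pow : ∀ g a k → conj g (pow a k) ≡ pow (conj g a) k
  conj-pow g a zero    = solve 1 (λ g → conjᵉ g one ⊜ one) refl g
  conj-pow g a (suc k) = trans
    (solve 3 (λ g a x → conjᵉ g (a ⊗ x) ⊜ conjᵉ g a ⊗ conjᵉ g x) refl g a (pow a k))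
    (cong (conj g a ·_) (conj-pow g a k))

  opaque
    -- Two of the first `suc n` powers of `a` coincide by the pigeonhole principle, and the smaller
    -- one is cancelled.
    torsion : ∀ a → ∃ λ d → 0 < d × pow a d ≡ e
    torsion a with Finₚ.pigeonhole (ℕₚ.n<1+n n) (λ i → pow a (toℕ i))
    ... | i , j , i<j , eq = toℕ j ∸ toℕ i , ℕₚ.m<n⇒0<n∸m i<j , (begin
      pow a (toℕ j ∸ toℕ i)                               ≡⟨ solve 2 (λ x y → x ⊜ (x ⊗ y) ⊗ y ⁻¹) refl _ (pow a (toℕ i)) ⟩
      (pow a (toℕ j ∸ toℕ i) · pow a (toℕ i)) · inv (pow a (toℕ i)) ≡⟨ cong (_· inv (pow a (toℕ i))) (pow-+ a (toℕ j ∸ toℕ i) (toℕ i)) ⟨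
      pow a (toℕ j ∸ toℕ i + toℕ i) · inv (pow a (toℕ i)) ≡⟨ cong (λ m → pow a m · inv (pow a (toℕ i))) (ℕₚ.m∸n+n≡m (ℕₚ.<⇒≤ i<j)) ⟩
      pow a (toℕ j) · inv (pow a (toℕ i))                 ≡⟨ cong (_· inv (pow a (toℕ i))) eq ⟨
      pow a (toℕ i) · inv (pow a (toℕ i))                 ≡⟨ invʳ _ ⟩
      e                                                   ∎)

    order : ∀ a → ∃ λ d → 0 < d × pow a d ≡ e × (∀ j → 0 < j → j < d → pow a j ≢ e)
    order a =
      let d₀ , 0<d₀ , eq₀ = torsion a
          d , (0<d , eq) , min = least (λ d → (0 ℕₚ.<? d) ×-dec (pow a d Finₚ.≟ e)) d₀ (0<d₀ , eq₀)
      in d , 0<d , eq , λ j 0<j j<d eqj → min j j<d (0<j , eqj)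

  infix 4 _∈ˢ_ _∈ˢ?_
  _∈ˢ_ : Fin n → Sub G → Set
  x ∈ˢ S = x ∈ proj₁ S

  _∈ˢ?_ : ∀ x S → Dec (x ∈ˢ S)
  x ∈ˢ? S = x ∈? proj₁ S

  e∈ : ∀ (S : Sub G) → e ∈ˢ S
  e∈ (_ , e∈S , _) = e∈S

  ·∈ : ∀ (S : Sub G) {a b} → a ∈ˢ S → b ∈ˢ S → (a · b) ∈ˢ S
  ·∈ (_ , _ , ·∈S , _) = ·∈S

  inv∈ : ∀ (S : Sub G) {a} → a ∈ˢ S → inv a ∈ˢ S
  inv∈ (_ , _ , _ , inv∈S) = inv∈S

  conj∈ : ∀ (S : Sub G) {a b} → a ∈ˢ S → b ∈ˢ S → conj a b ∈ˢ S
  conj∈ S a∈ b∈ = ·∈ S (·∈ S a∈ b∈) (inv∈ S a∈)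

  comm∈ : ∀ (S : Sub G) {a b} → a ∈ˢ S → b ∈ˢ S → comm a b ∈ˢ S
  comm∈ S a∈ b∈ = ·∈ S (conj∈ S a∈ b∈) (inv∈ S b∈)

  pow∈ : ∀ (S : Sub G) {a} k → a ∈ˢ S → pow a k ∈ˢ S
  pow∈ S zero    a∈ = e∈ S
  pow∈ S (suc k) a∈ = ·∈ S a∈ (pow∈ S k a∈)

  inv≡pow : ∀ a → ∃ λ k → inv a ≡ pow a k
  inv≡pow a with torsion a
  ... | suc k , _ , eq = k , sym (inv-unique a _ eq)

  -- By finiteness closure under multiplication suffices.
  module _ {P : Pred (Fin n) 0ℓ} (P? : Decidable P) (Pe : P e) (P· : ∀ {a b} → P a → P b → P (a · b)) where

    private
      Ppow : ∀ {a} k → P a → P (pow a k)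
      Ppow zero    p = Pe
      Ppow (suc k) p = P· p (Ppow k p)

    subgroup : Sub G
    subgroup = ⟪ P? ⟫ , ∈⟪⟫⁺ P? Pe
      , (λ a∈ b∈ → ∈⟪⟫⁺ P? (P· (∈⟪⟫⁻ P? a∈) (∈⟪⟫⁻ P? b∈)))
      , (λ {a} a∈ → ∈⟪⟫⁺ P? (subst P (sym (proj₂ (inv≡pow a))) (Ppow (proj₁ (inv≡pow a)) (∈⟪⟫⁻ P? a∈))))

  isSubgroup? : ∀ S → Dec (IsSubgroup G S)
  isSubgroup? S = (e ∈? S)
    ×-dec map′ (λ f {a} {b} → f a b) (λ f a b → f {a} {b})
      (all? λ a → all? λ b → (a ∈? S) →-dec ((b ∈? S) →-dec ((a · b) ∈? S)))
    ×-dec map′ (λ f {a} → f a) (λ f a → f {a}) (all? λ a → (a ∈? S) →-dec (inv a ∈? S))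

  leftCoset-isDecEquivalence : ∀ (S : Sub G) → IsDecEquivalence (λ a b → (inv a · b) ∈ˢ S)
  leftCoset-isDecEquivalence S = record
    { isEquivalence = record
      { refl = λ {a} → subst (_∈ˢ S) (sym (invˡ a)) (e∈ S)
      ; sym = λ {a} {b} ab∈ → subst (_∈ˢ S) (solve 2 (λ a b → (a ⁻¹ ⊗ b) ⁻¹ ⊜ b ⁻¹ ⊗ a) refl a b) (inv∈ S ab∈)
      ; trans = λ {a} {b} {c} ab∈ bc∈ → subst (_∈ˢ S)
          (solve 3 (λ a b c → (a ⁻¹ ⊗ b) ⊗ (b ⁻¹ ⊗ c) ⊜ a ⁻¹ ⊗ c) refl a b c) (·∈ S ab∈ bc∈)
      }
    ; _≟_ = λ a b → (inv a · b) ∈ˢ? S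
    }

  -- If d is the order of k and g = gcd ℓ d, then k^(d/g) has order g < q, so g = 1.
  root∈ : ∀ {q} → (∀ d x → 0 < d → d < q → pow x d ≡ e → x ≡ e) →
          ∀ (S : Sub G) ℓ k → 0 < ℓ → ℓ < q → pow k ℓ ∈ˢ S → k ∈ˢ S
  root∈ {q} no-small-order S ℓ k 0<ℓ ℓ<q kℓ∈ with order k
  ... | d , 0<d , kd≡e , min with Bézout.lemma ℓ d
  ... | Bézout.result zero g _ = contradiction (GCD.gcd∣m g) λ { (divides c eq) →
          ℕₚ.<-irrefl (sym (trans eq (ℕₚ.*-zeroʳ c))) 0<ℓ }
  ... | Bézout.result (suc (suc g)) gcd _ = contradiction kt≡e (min t 0<t t<d)
    where
    g∣ℓ = GCD.gcd∣m gcd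
    t = Div.quotient (GCD.gcd∣n gcd)
    d≡ : d ≡ t * suc (suc g)
    d≡ = Div._∣_.equality (GCD.gcd∣n gcd)
    0<t : 0 < t
    0<t = ℕₚ.n≢0⇒n>0 λ t≡0 → ℕₚ.<-irrefl (sym (trans d≡ (cong (_* suc (suc g)) t≡0))) 0<d
    t<d : t < d
    t<d = subst (t <_) (sym d≡) (ℕₚ.m<m*n t (suc (suc g)) {{>-nonZero 0<t}} (s≤s (s≤s z≤n)))
    kt≡e : pow k t ≡ e
    kt≡e = no-small-order (suc (suc g)) (pow k t) (s≤s z≤n)
      (ℕₚ.≤-<-trans (∣⇒≤ {{>-nonZero 0<ℓ}} g∣ℓ) ℓ<q)
      (trans (sym (pow-* k (suc (suc g)) t)) (trans (cong (pow k) (trans (ℕₚ.*-comm (suc (suc g)) t) (sym d≡))) kd≡e))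
  -- Now `ℓ` and `d` are coprime. In the two Bézout cases `pow (pow k ℓ) x` is `k` and `inv k`
  -- respectively.
  ... | Bézout.result (suc zero) _ (Bézout.+- x y eq) = subst (_∈ˢ S) (begin
          pow (pow k ℓ) x   ≡⟨ pow-* k x ℓ ⟨
          pow k (x * ℓ)     ≡⟨ cong (pow k) eq ⟨
          k · pow k (y * d) ≡⟨ cong (k ·_) (pow-*≡e y kd≡e) ⟩
          k · e             ≡⟨ idʳ k ⟩
          k                 ∎) (pow∈ S x kℓ∈)
  ... | Bézout.result (suc zero) _ (Bézout.-+ x y eq) = subst (_∈ˢ S) (begin
          inv (pow (pow k ℓ) x)             ≡⟨ cong inv (pow-* k x ℓ) ⟨
          inv (pow k (x * ℓ))               ≡⟨ solve 2 (λ k z → z ⁻¹ ⊜ (k ⊗ z) ⁻¹ ⊗ k) refl k _ ⟩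
          inv (k · pow k (x * ℓ)) · k       ≡⟨ cong (λ z → inv z · k) (trans (cong (pow k) eq) (pow-*≡e y kd≡e)) ⟩
          inv e · k                         ≡⟨ solve 1 (λ k → one ⁻¹ ⊗ k ⊜ k) refl k ⟩
          k                                 ∎) (inv∈ S (pow∈ S x kℓ∈))

-- Subgroups that meet every subgroup maximally, and the action of a normalizer.

module Maximality {n : ℕ} (G : FinGroup n) where
  open GroupTheory G
  open ≡-Reasoning

  -- M ∩ Y is Y or a maximal subgroup of Y, for every subgroup Y.
  MeetsMaximally : Sub G → Set
  MeetsMaximally M = ∀ (X Y : Sub G) → proj₁ X ⊆ proj₁ Y → (∀ {a} → a ∈ˢ M → a ∈ˢ Y → a ∈ˢ X) →
    (proj₁ X ⊆ proj₁ M) ⊎ (proj₁ Y ⊆ proj₁ X)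

  -- Maximality as an induction principle. The elements of `Y` satisfying `P` form a subgroup `X`
  -- that contains the intersection of `M` and `Y`; the element `a` shows that `X` is not inside
  -- `M`, so `X` is all of `Y`.
  fill : ∀ {M} → MeetsMaximally M → (Y : Sub G) {P : Pred (Fin n) 0ℓ} (P? : Decidable P) → P e →
    (∀ {a b} → a ∈ˢ Y → b ∈ˢ Y → P a → P b → P (a · b)) →
    (∀ {a} → a ∈ˢ M → a ∈ˢ Y → P a) →
    ∀ {a} → a ∈ˢ Y → P a → ¬ (a ∈ˢ M) → ∀ {y} → y ∈ˢ Y → P y
  fill {M} M-max Y {P} P? Pe P· P-M a∈Y Pa a∉M y∈Y =
    [ (λ X⊆M → contradiction (X⊆M (∈⟪⟫⁺ X? (a∈Y , Pa))) a∉M)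
    , (λ Y⊆X → proj₂ (∈⟪⟫⁻ X? (Y⊆X y∈Y)))
    ]′ (M-max X Y (proj₁ ∘ ∈⟪⟫⁻ X?) (λ m∈M m∈Y → ∈⟪⟫⁺ X? (m∈Y , P-M m∈M m∈Y)))
    where
    X? = λ x → (x ∈ˢ? Y) ×-dec P? x
    X = subgroup X? (e∈ Y , Pe) (λ (a∈ , pa) (b∈ , pb) → ·∈ Y a∈ b∈ , P· a∈ b∈ pa pb)

  conj-· : ∀ g a b → conj g (a · b) ≡ conj g a · conj g b
  conj-· = solve 3 (λ g a b → conjᵉ g (a ⊗ b) ⊜ conjᵉ g a ⊗ conjᵉ g b) refl

  conj-conj : ∀ g h a → conj (g · h) a ≡ conj g (conj h a)
  conj-conj = solve 3 (λ g h a → conjᵉ (g ⊗ h) a ⊜ conjᵉ g (conjᵉ h a)) refl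

  conj-inv-conj : ∀ g a → conj (inv g) (conj g a) ≡ a
  conj-inv-conj = solve 2 (λ g a → conjᵉ (g ⁻¹) (conjᵉ g a) ⊜ a) refl

  conj-e : ∀ g → conj g e ≡ e
  conj-e = solve 1 (λ g → conjᵉ g one ⊜ one) refl

  e-conj : ∀ a → conj e a ≡ a
  e-conj = solve 1 (λ a → conjᵉ one a ⊜ a) refl

  comm-·ˡ : ∀ a b u → comm (a · b) u ≡ conj a (comm b u) · comm a u
  comm-·ˡ = solve 3 (λ a b u → commᵉ (a ⊗ b) u ⊜ conjᵉ a (commᵉ b u) ⊗ commᵉ a u) refl

  comm-eˡ : ∀ u → comm e u ≡ e
  comm-eˡ = solve 1 (λ u → commᵉ one u ⊜ one) refl

  commute⇒comm≡e : ∀ a b → a · b ≡ b · a → comm a b ≡ e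
  commute⇒comm≡e a b eq = trans (cong (_· inv b) (commute⇒conj≡ a b eq)) (invʳ b)

  conjugate? : ∀ g (S : Sub G) → Decidable (λ x → conj (inv g) x ∈ˢ S)
  conjugate? g S x = conj (inv g) x ∈ˢ? S

  conjugate : Fin n → Sub G → Sub G
  conjugate g S = subgroup (conjugate? g S) (subst (_∈ˢ S) (sym (conj-e _)) (e∈ S))
    (λ a∈ b∈ → subst (_∈ˢ S) (sym (conj-· _ _ _)) (·∈ S a∈ b∈))

  -- Conjugating `X` and `Y` by `inv g` reduces the claim to `M` itself.
  conjugate-meetsMaximally : ∀ g {M} → MeetsMaximally M → MeetsMaximally (conjugate g M)
  conjugate-meetsMaximally g {M} M-max X Y X⊆Y MY⊆X
    with M-max (conjugate (inv g) X) (conjugate (inv g) Y)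
           (λ a∈ → ∈⟪⟫⁺ (conjugate? (inv g) Y) (X⊆Y (∈⟪⟫⁻ (conjugate? (inv g) X) a∈)))
           (λ {a} a∈M a∈Y → ∈⟪⟫⁺ (conjugate? (inv g) X) (MY⊆X
             (∈⟪⟫⁺ (conjugate? g M) (subst (_∈ˢ M) (sym (back a)) a∈M))
             (∈⟪⟫⁻ (conjugate? (inv g) Y) a∈Y)))
    where
    back : ∀ a → conj (inv g) (conj (inv (inv g)) a) ≡ a
    back = solve 2 (λ g a → conjᵉ (g ⁻¹) (conjᵉ (g ⁻¹ ⁻¹) a) ⊜ a) refl g
  ... | inj₁ X⊆M = inj₁ λ {x} x∈X → ∈⟪⟫⁺ (conjugate? g M) (X⊆M (∈⟪⟫⁺ (conjugate? (inv g) X)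
          (subst (_∈ˢ X) (solve 2 (λ g a → a ⊜ conjᵉ (g ⁻¹ ⁻¹) (conjᵉ (g ⁻¹) a)) refl g x) x∈X)))
  ... | inj₂ Y⊆X = inj₂ λ {y} y∈Y → subst (_∈ˢ X) (solve 2 (λ g a → conjᵉ (g ⁻¹ ⁻¹) (conjᵉ (g ⁻¹) a) ⊜ a) refl g y)
          (∈⟪⟫⁻ (conjugate? (inv g) X) (Y⊆X (∈⟪⟫⁺ (conjugate? (inv g) Y)
            (subst (_∈ˢ Y) (solve 2 (λ g a → a ⊜ conjᵉ (g ⁻¹ ⁻¹) (conjᵉ (g ⁻¹) a)) refl g y) y∈Y))))

  pow-% : ∀ {a p} → pow a (suc p) ≡ e → ∀ k → pow a (k % suc p) ≡ pow a k
  pow-% {a} {p} eq k = begin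
    pow a (k % suc p)                                  ≡⟨ idʳ _ ⟨
    pow a (k % suc p) · e                              ≡⟨ cong (pow a (k % suc p) ·_) (pow-*≡e (k / suc p) eq) ⟨
    pow a (k % suc p) · pow a (k / suc p * suc p)      ≡⟨ pow-+ a (k % suc p) _ ⟨
    pow a (k % suc p + k / suc p * suc p)              ≡⟨ cong (pow a) (m≡m%n+[m/n]*n k (suc p)) ⟨
    pow a k                                            ∎

  pow-Fin : ∀ {a p} → pow a (suc p) ≡ e → ∀ k → ∃ λ (j : Fin (suc p)) → pow a (toℕ j) ≡ pow a k
  pow-Fin {a} {p} eq k = fromℕ< (m%n<n k (suc p)) ,
    trans (cong (pow a) (Finₚ.toℕ-fromℕ< (m%n<n k (suc p)))) (pow-% eq k)

  -- The elements of `Y` lying in some coset of `L` by a power of `u` are closed under products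
  -- because `u` is central in `Y`. They include `u` and the intersection of `L` and `Y`, so `fill`
  -- applies.
  cyclic-quotient : ∀ {L} → MeetsMaximally L → (Y : Sub G) → ∀ {u p} → u ∈ˢ Y → ¬ (u ∈ˢ L) →
    (∀ {y} → y ∈ˢ Y → u · y ≡ y · u) → pow u (suc p) ≡ e →
    ∀ {y} → y ∈ˢ Y → ∃ λ (j : Fin (suc p)) → (inv (pow u (toℕ j)) · y) ∈ˢ L
  cyclic-quotient {L} L-max Y {u} {p} u∈Y u∉L central uq≡e =
    fill {L} L-max Y (λ y → any? λ j → (inv (pow u (toℕ j)) · y) ∈ˢ? L)
      (zero , subst (_∈ˢ L) (solve 0 (one ⊜ one ⁻¹ ⊗ one) refl) (e∈ L))
      closed
      (λ {a} a∈L _ → zero , subst (_∈ˢ L) (solve 1 (λ a → a ⊜ one ⁻¹ ⊗ a) refl a) a∈L)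
      u∈Y
      -- The exponent 1 is reduced through `pow-Fin` because `suc p` may be 1 as far as the types
      -- know.
      (let j , eq = pow-Fin {u} {p} uq≡e 1 in j , subst (_∈ˢ L) (sym (begin
        inv (pow u (toℕ j)) · u ≡⟨ cong (λ v → inv v · u) eq ⟩
        inv (u · e) · u         ≡⟨ solve 1 (λ u → (u ⊗ one) ⁻¹ ⊗ u ⊜ one) refl u ⟩
        e                       ∎)) (e∈ L))
      u∉L
    where
    closed : ∀ {a b} → a ∈ˢ Y → b ∈ˢ Y →
      (∃ λ (j : Fin (suc p)) → (inv (pow u (toℕ j)) · a) ∈ˢ L) →
      (∃ λ (j : Fin (suc p)) → (inv (pow u (toℕ j)) · b) ∈ˢ L) →
      ∃ λ (j : Fin (suc p)) → (inv (pow u (toℕ j)) · (a · b)) ∈ˢ L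
    closed {a} {b} a∈Y b∈Y (i , a∈) (j , b∈) =
      let k , eq = pow-Fin {u} {p} uq≡e (toℕ j + toℕ i)
          v = pow u (toℕ j)
          w = pow u (toℕ i)
          va≡av = pow-commute (toℕ j) (central a∈Y)
      in k , subst (_∈ˢ L) (begin
        (inv w · a) · (inv v · b)               ≡⟨ solve 4 (λ v w a b → (w ⁻¹ ⊗ a) ⊗ (v ⁻¹ ⊗ b) ⊜ w ⁻¹ ⊗ (v ⁻¹ ⊗ (v ⊗ a)) ⊗ v ⁻¹ ⊗ b) refl v w a b ⟩
        ((inv w · (inv v · (v · a))) · inv v) · b ≡⟨ cong (λ z → ((inv w · (inv v · z)) · inv v) · b) va≡av ⟩
        ((inv w · (inv v · (a · v))) · inv v) · b ≡⟨ solve 4 (λ v w a b → w ⁻¹ ⊗ (v ⁻¹ ⊗ (a ⊗ v)) ⊗ v ⁻¹ ⊗ b ⊜ (v ⊗ w) ⁻¹ ⊗ (a ⊗ b)) refl v w a b ⟩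
        inv (v · w) · (a · b)                   ≡⟨ cong (λ z → inv z · (a · b)) (trans eq (pow-+ u (toℕ j) (toℕ i))) ⟨
        inv (pow u (toℕ k)) · (a · b)           ∎) (·∈ L a∈ b∈)

  -- In a finite group a conjugate of `Q` contained in `Q` equals `Q`, so this one inclusion defines
  -- the usual normalizer.
  normalizes? : ∀ (Q : Sub G) → Decidable (λ k → ∀ u → u ∈ˢ Q → conj k u ∈ˢ Q)
  normalizes? Q k = all? λ u → (u ∈ˢ? Q) →-dec (conj k u ∈ˢ? Q)

  normalizer : Sub G → Sub G
  normalizer Q = subgroup (normalizes? Q) (λ u u∈ → subst (_∈ˢ Q) (sym (e-conj u)) u∈)
    λ {a} {b} a∈ b∈ u u∈ → subst (_∈ˢ Q) (sym (conj-conj a b u)) (a∈ _ (b∈ u u∈))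

  normalizer-conj : ∀ Q {k u} → k ∈ˢ normalizer Q → u ∈ˢ Q → conj k u ∈ˢ Q
  normalizer-conj Q k∈ u∈ = ∈⟪⟫⁻ (normalizes? Q) k∈ _ u∈

  ⊆-normalizer : ∀ Q → proj₁ Q ⊆ proj₁ (normalizer Q)
  ⊆-normalizer Q k∈ = ∈⟪⟫⁺ (normalizes? Q) λ u u∈ → conj∈ Q k∈ u∈

  -- The trivial group satisfies this; `SimpleGroup` excludes it through an element outside `M`.
  Simple : Set
  Simple = ∀ (J : Sub G) → (∀ g {a} → a ∈ˢ J → conj g a ∈ˢ J) → (∀ {a} → a ∈ˢ J → a ≡ e) ⊎ (∀ a → a ∈ˢ J)

  -- For the least order `q` of a nontrivial element, this does the work of `q` being the smallest
  -- prime divisor of the group order.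
  NoSmallOrder : ℕ → Set
  NoSmallOrder q = ∀ d x → 0 < d → d < q → pow x d ≡ e → x ≡ e

  module _ {p} (no-small : NoSmallOrder (suc p)) (Q : Sub G)
           (abelian : ∀ {a b} → a ∈ˢ Q → b ∈ˢ Q → a · b ≡ b · a)
           (exponent : ∀ {a} → a ∈ˢ Q → pow a (suc p) ≡ e)
           {L : Sub G} (L-max : MeetsMaximally L) where

    private
      N = normalizer Q

      -- The property "carries the intersection of `Q` and `L` into `L`" holds for the elements of
      -- `L` in `N`, and for `a`, which centralizes `Q`. By `fill` it spreads to all of `N`.
      normal : ∀ {a} → a ∈ˢ Q → ¬ (a ∈ˢ L) → ∀ {k} → k ∈ˢ N → ∀ c → c ∈ˢ Q → c ∈ˢ L → conj k c ∈ˢ L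
      normal a∈Q a∉L = fill {L} L-max N (λ k → all? λ c → (c ∈ˢ? Q) →-dec ((c ∈ˢ? L) →-dec (conj k c ∈ˢ? L)))
        (λ c _ c∈L → subst (_∈ˢ L) (sym (e-conj c)) c∈L)
        (λ {a} {b} _ b∈N pa pb c c∈Q c∈L →
          subst (_∈ˢ L) (sym (conj-conj a b c)) (pa _ (normalizer-conj Q b∈N c∈Q) (pb c c∈Q c∈L)))
        (λ k∈L _ c _ c∈L → conj∈ L k∈L c∈L)
        (⊆-normalizer Q a∈Q)
        (λ c c∈Q c∈L → subst (_∈ˢ L) (sym (commute⇒conj≡ _ c (abelian a∈Q c∈Q))) c∈L)
        a∉L

      -- The p nontrivial cosets of Q ∩ L are permuted by k, so some k^ℓ with ℓ ≤ p fixes u(Q ∩ L).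
      moved : ∀ {k u} → k ∈ˢ N → u ∈ˢ Q → ¬ (u ∈ˢ L) → comm k u ∈ˢ L
      moved {k} {u} k∈N u∈Q u∉L =
        proj₂ (∈⟪⟫⁻ fixes? (root∈ no-small S (toℕ t ∸ toℕ s) k (ℕₚ.m<n⇒0<n∸m s<t)
          (ℕₚ.≤-<-trans (ℕₚ.m∸n≤m (toℕ t) (toℕ s)) (Finₚ.toℕ<n t))
          (∈⟪⟫⁺ fixes? (pow∈ N (toℕ t ∸ toℕ s) k∈N , fixed))))
        where
        fixes? = λ k → (k ∈ˢ? N) ×-dec (comm k u ∈ˢ? L)

        comm∈Q : ∀ {k} → k ∈ˢ N → comm k u ∈ˢ Q
        comm∈Q k∈ = ·∈ Q (normalizer-conj Q k∈ u∈Q) (inv∈ Q u∈Q)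

        -- The stabilizer in `N` of the coset of `u` modulo the intersection of `Q` and `L`:
        -- `conj k u` lies in that coset exactly when `comm k u` lies in `L`.
        S : Sub G
        S = subgroup fixes? (e∈ N , subst (_∈ˢ L) (sym (comm-eˡ u)) (e∈ L))
          λ {a} {b} (a∈N , a∈) (b∈N , b∈) → ·∈ N a∈N b∈N , subst (_∈ˢ L) (sym (comm-·ˡ a b u))
            (·∈ L (normal u∈Q u∉L a∈N _ (comm∈Q b∈N) b∈) a∈)

        z : Fin (suc p) → Fin n
        z s = conj (pow k (toℕ s)) u

        z∈Q : ∀ s → z s ∈ˢ Q
        z∈Q s = normalizer-conj Q (pow∈ N (toℕ s) k∈N) u∈Q

        pull-back : ∀ s {w} → w ∈ˢ Q → w ∈ˢ L → conj (inv (pow k (toℕ s))) w ∈ˢ L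
        pull-back s = normal u∈Q u∉L (inv∈ N (pow∈ N (toℕ s) k∈N)) _

        coset : ∀ s → ∃ λ (j : Fin (suc p)) → (inv (pow u (toℕ j)) · z s) ∈ˢ L
        coset s = cyclic-quotient {L} L-max Q u∈Q u∉L (abelian u∈Q) (exponent u∈Q) (z∈Q s)

        -- If `z s` were in `L`, conjugating it back by the power of `k` would put `u` in `L`.
        coset≢0 : ∀ s → zero ≢ proj₁ (coset s)
        coset≢0 s eq = u∉L (subst (_∈ˢ L) (conj-inv-conj (pow k (toℕ s)) u)
          (pull-back s (z∈Q s) (subst (_∈ˢ L)
            (trans (cong (λ j → inv (pow u (toℕ j)) · z s) (sym eq)) (solve 1 (λ a → one ⁻¹ ⊗ a ⊜ a) refl (z s)))
            (proj₂ (coset s)))))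

        -- Removing the trivial coset leaves `p` values for `suc p` exponents, so two exponents
        -- collide and their difference is positive and less than `suc p`.
        collision = Finₚ.pigeonhole (ℕₚ.n<1+n p) (λ s → Fin.punchOut (coset≢0 s))
        s = proj₁ collision
        t = proj₁ (proj₂ collision)
        s<t = proj₁ (proj₂ (proj₂ collision))

        same-coset : proj₁ (coset s) ≡ proj₁ (coset t)
        same-coset = Finₚ.punchOut-injective (coset≢0 s) (coset≢0 t) (proj₂ (proj₂ (proj₂ collision)))

        w : Fin n
        w = inv (z s) · z t

        w∈L : w ∈ˢ L
        w∈L = subst (_∈ˢ L)
          (solve 3 (λ v a b → (v ⁻¹ ⊗ a) ⁻¹ ⊗ (v ⁻¹ ⊗ b) ⊜ a ⁻¹ ⊗ b) refl (pow u (toℕ (proj₁ (coset t)))) (z s) (z t))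
          (·∈ L (inv∈ L (subst (λ j → (inv (pow u (toℕ j)) · z s) ∈ˢ L) same-coset (proj₂ (coset s)))) (proj₂ (coset t)))

        b = pow k (toℕ t ∸ toℕ s)

        fixed : comm b u ∈ˢ L
        fixed = subst (_∈ˢ L) (begin
          conj (inv (pow k (toℕ s))) w                        ≡⟨ cong (conj _) (abelian (inv∈ Q (z∈Q s)) (z∈Q t)) ⟩
          conj (inv (pow k (toℕ s))) (z t · inv (z s))        ≡⟨ cong (λ m → conj (inv (pow k (toℕ s))) (conj (pow k m) u · inv (z s)))
                                                                  (ℕₚ.m+[n∸m]≡n (ℕₚ.<⇒≤ s<t)) ⟨
          conj (inv ks) (conj (pow k (toℕ s + (toℕ t ∸ toℕ s))) u · inv (z s))
                                                              ≡⟨ cong (λ m → conj (inv ks) (conj m u · inv (z s))) (pow-+ k (toℕ s) (toℕ t ∸ toℕ s)) ⟩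
          conj (inv ks) (conj (ks · b) u · inv (conj ks u))   ≡⟨ solve 3 (λ a b u → conjᵉ (a ⁻¹) (conjᵉ (a ⊗ b) u ⊗ (conjᵉ a u) ⁻¹) ⊜ commᵉ b u) refl ks b u ⟩
          comm b u                                            ∎)
          (pull-back s (·∈ Q (inv∈ Q (z∈Q s)) (z∈Q t)) w∈L)
          where ks = pow k (toℕ s)

    -- If `u` is in `L` but `conj k u` is not, then `conj k u` itself can serve as the element of
    -- `Q` outside `L` in `normal`, which then puts it in `L`, a contradiction.
    normalizer-comm∈ : ∀ {k u} → k ∈ˢ normalizer Q → u ∈ˢ Q → comm k u ∈ˢ L
    normalizer-comm∈ {k} {u} k∈N u∈Q with u ∈ˢ? L | conj k u ∈ˢ? L
    ... | no u∉L  | _         = moved k∈N u∈Q u∉L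
    ... | yes u∈L | yes ku∈L  = ·∈ L ku∈L (inv∈ L u∈L)
    ... | yes u∈L | no  ku∉L  = contradiction (normal (normalizer-conj Q k∈N u∈Q) ku∉L k∈N u u∈Q u∈L) ku∉L

-- The transfer homomorphism into an abelian group, and its value on a central element.

module _ {n : ℕ} (G : FinGroup n) (A : AbelianGroup 0ℓ 0ℓ) where
  open GroupTheory G
  open Maximality G using (NoSmallOrder; Simple)
  open AbelianGroup A using (Carrier; _≈_; _∙_; ε)

  module Transfer (C : Sub G)
    (φ : ∀ {c} → c ∈ˢ C → Carrier)
    (φ-cong : ∀ {c d} (c∈ : c ∈ˢ C) (d∈ : d ∈ˢ C) → c ≡ d → φ c∈ ≈ φ d∈)
    (φ-· : ∀ {c d} (c∈ : c ∈ˢ C) (d∈ : d ∈ˢ C) → φ (·∈ C c∈ d∈) ≈ φ c∈ ∙ φ d∈) where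

    open AbelianGroup A using (commutativeMonoid; ∙-cong; ∙-congˡ; ∙-congʳ; identityˡ; identityʳ; inverseʳ; ⁻¹-cong)
      renaming (_⁻¹ to _⁻; refl to ≈-refl; sym to ≈-sym; trans to ≈-trans; reflexive to ≈-reflexive; setoid to ≈-setoid)
    open import Algebra.Properties.AbelianGroup A using (⁻¹-∙-comm)
    open Sum commutativeMonoid
    open Summation commutativeMonoid
    open CMSolver commutativeMonoid using (_⊕_) renaming (solve to solveᶜ; _⊜_ to _⊜ᶜ_)
    open import Relation.Binary.Reasoning.Setoid ≈-setoid

    telescope : ∀ m (t : ℕ → Carrier) → ∑[ k < m ] (t (suc (toℕ k)) ∙ t (toℕ k) ⁻) ≈ t m ∙ t 0 ⁻
    telescope zero    t = ≈-sym (inverseʳ (t 0))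
    telescope (suc m) t = begin
      (t 1 ∙ t 0 ⁻) ∙ (∑[ k < m ] (t (suc (suc (toℕ k))) ∙ t (suc (toℕ k)) ⁻)) ≈⟨ ∙-congˡ (telescope m (t ∘ suc)) ⟩
      (t 1 ∙ t 0 ⁻) ∙ (t (suc m) ∙ t 1 ⁻)   ≈⟨ solveᶜ 4 (λ a b c d → (a ⊕ b) ⊕ (c ⊕ d) ⊜ᶜ (a ⊕ d) ⊕ (c ⊕ b)) ≈-refl (t 1) (t 0 ⁻) (t (suc m)) (t 1 ⁻) ⟩
      (t 1 ∙ t 1 ⁻) ∙ (t (suc m) ∙ t 0 ⁻)   ≈⟨ ∙-congʳ (inverseʳ (t 1)) ⟩
      ε ∙ (t (suc m) ∙ t 0 ⁻)               ≈⟨ identityˡ _ ⟩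
      t (suc m) ∙ t 0 ⁻                     ∎

    _~_ : Rel (Fin n) 0ℓ
    h ~ h′ = (inv h · h′) ∈ˢ C

    ~-isDecEquivalence : IsDecEquivalence _~_
    ~-isDecEquivalence = leftCoset-isDecEquivalence C
    open IsDecEquivalence ~-isDecEquivalence public using () renaming (refl to ~-refl; sym to ~-sym; trans to ~-trans)

    private
      cosets : Classes (λ _ → Unit.⊤) _~_
      cosets = classes (λ _ → yes tt) ~-isDecEquivalence

    open Classes cosets public using (size; rep)

    coset : Fin n → Fin size
    coset h = Classes.cls cosets h tt

    rep-coset : ∀ h → rep (coset h) ~ h
    rep-coset h = Classes.rep-cls cosets h tt

    coset-cong : ∀ {h h′} → h ~ h′ → coset h ≡ coset h′
    coset-cong {h} {h′} eq = Classes.rep-unique cosets _ _ (~-trans (rep-coset h) (~-trans eq (~-sym (rep-coset h′))))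

    coset-~ : ∀ {h h′} → coset h ≡ coset h′ → h ~ h′
    coset-~ {h} {h′} eq = ~-trans (~-sym (rep-coset h)) (subst (λ i → rep i ~ h′) (sym eq) (rep-coset h′))

    coset-rep : ∀ i → coset (rep i) ≡ i
    coset-rep i = Classes.rep-unique cosets _ _ (rep-coset (rep i))

    ~-left : ∀ g {h h′} → h ~ h′ → (g · h) ~ (g · h′)
    ~-left g {h} {h′} = subst (_∈ˢ C) (solve 3 (λ g h h′ → h ⁻¹ ⊗ h′ ⊜ (g ⊗ h) ⁻¹ ⊗ (g ⊗ h′)) refl g h h′)

    act : Fin n → Fin size → Fin size
    act g i = coset (g · rep i)

    act-coset : ∀ g h → act g (coset h) ≡ coset (g · h)
    act-coset g h = coset-cong (~-left g (rep-coset h))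

    act-· : ∀ g h i → act (g · h) i ≡ act g (act h i)
    act-· g h i = trans (cong coset (assoc g h (rep i))) (sym (act-coset g (h · rep i)))

    act-e : ∀ i → act e i ≡ i
    act-e i = trans (cong coset (idˡ _)) (coset-rep i)

    act-inv : ∀ g i → act (inv g) (act g i) ≡ i
    act-inv g i = trans (sym (act-· _ _ i)) (trans (cong (λ h → act h i) (invˡ g)) (act-e i))

    act-inv′ : ∀ g i → act g (act (inv g) i) ≡ i
    act-inv′ g i = trans (sym (act-· _ _ i)) (trans (cong (λ h → act h i) (invʳ g)) (act-e i))

    iter-act : ∀ g k i → iter (act g) k i ≡ act (pow g k) i
    iter-act g zero    i = sym (act-e i)
    iter-act g (suc k) i = trans (cong (act g) (iter-act g k i)) (sym (act-· g (pow g k) i))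

    -- A map G → A that is equivariant for right multiplication by C.
    shift : Fin n → Carrier
    shift h = φ (rep-coset h)

    shift-cong : ∀ {g h} → g ≡ h → shift g ≈ shift h
    shift-cong eq = ≈-reflexive (cong shift eq)

    shift-· : ∀ h {c} (c∈ : c ∈ˢ C) → shift (h · c) ≈ shift h ∙ φ c∈
    shift-· h {c} c∈ = ≈-trans
      (φ-cong _ _ (trans (cong (λ i → inv (rep i) · (h · c)) (coset-cong hc~h)) (sym (assoc _ _ _))))
      (φ-· (rep-coset h) c∈)
      where
      hc~h : (h · c) ~ h
      hc~h = subst (_∈ˢ C) (solve 2 (λ h c → c ⁻¹ ⊜ (h ⊗ c) ⁻¹ ⊗ h) refl h c) (inv∈ C c∈)

    -- The factor of one coset in the transfer. At `rep i` it is the classical factor, `φ` of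
    -- `inv (rep (act g i)) · (g · rep i)`; as a quotient of values of `shift` it makes sense for
    -- every `h` and telescopes along the powers of `g`.
    δ : Fin n → Fin n → Carrier
    δ g h = shift (g · h) ∙ shift h ⁻

    -- Multiplying `h` on the right by `c` in `C` changes both values of `shift` by the same `φ c`,
    -- which cancels.
    δ-cong : ∀ g {h h′} → h ~ h′ → δ g h ≈ δ g h′
    δ-cong g {h} {h′} c∈ = ≈-sym (begin
      shift (g · h′) ∙ shift h′ ⁻           ≈⟨ ∙-cong (shift-cong (solve 3 (λ g h h′ → g ⊗ h′ ⊜ (g ⊗ h) ⊗ (h ⁻¹ ⊗ h′)) refl g h h′))
                                                     (⁻¹-cong (shift-cong (sym (cancelˡ′ h h′)))) ⟩
      shift ((g · h) · (inv h · h′)) ∙ shift (h · (inv h · h′)) ⁻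
                                            ≈⟨ ∙-cong (shift-· (g · h) c∈) (⁻¹-cong (shift-· h c∈)) ⟩
      (shift (g · h) ∙ φ c∈) ∙ (shift h ∙ φ c∈) ⁻ ≈⟨ ∙-congˡ (⁻¹-∙-comm (shift h) (φ c∈)) ⟨
      (shift (g · h) ∙ φ c∈) ∙ (shift h ⁻ ∙ φ c∈ ⁻) ≈⟨ solveᶜ 4 (λ a b c d → (a ⊕ c) ⊕ (b ⊕ d) ⊜ᶜ (a ⊕ b) ⊕ (c ⊕ d)) ≈-refl
                                                      (shift (g · h)) (shift h ⁻) (φ c∈) (φ c∈ ⁻) ⟩
      δ g h ∙ (φ c∈ ∙ φ c∈ ⁻)               ≈⟨ ∙-congˡ (inverseʳ (φ c∈)) ⟩
      δ g h ∙ ε                             ≈⟨ identityʳ _ ⟩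
      δ g h                                 ∎)

    δ-rep : ∀ g h → δ g (rep (coset h)) ≈ δ g h
    δ-rep g h = δ-cong g (rep-coset h)

    δ-fixed : ∀ g h (c∈ : conj (inv h) g ∈ˢ C) → δ g h ≈ φ c∈
    δ-fixed g h c∈ = begin
      shift (g · h) ∙ shift h ⁻               ≈⟨ ∙-congʳ (shift-cong (solve 2 (λ g h → g ⊗ h ⊜ h ⊗ conjᵉ (h ⁻¹) g) refl g h)) ⟩
      shift (h · conj (inv h) g) ∙ shift h ⁻  ≈⟨ ∙-congʳ (shift-· h c∈) ⟩
      (shift h ∙ φ c∈) ∙ shift h ⁻            ≈⟨ solveᶜ 3 (λ a b c → (a ⊕ b) ⊕ c ⊜ᶜ b ⊕ (a ⊕ c)) ≈-refl (shift h) (φ c∈) (shift h ⁻) ⟩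
      φ c∈ ∙ (shift h ∙ shift h ⁻)            ≈⟨ ∙-congˡ (inverseʳ (shift h)) ⟩
      φ c∈ ∙ ε                                ≈⟨ identityʳ _ ⟩
      φ c∈                                    ∎

    transfer : Fin n → Carrier
    transfer g = ∑[ i < size ] δ g (rep i)

    -- By the cocycle identity `split`, the factors of `g` are taken at the cosets moved by `h`;
    -- since `act h` is a permutation, they can be reindexed.
    transfer-· : ∀ g h → transfer (g · h) ≈ transfer g ∙ transfer h
    transfer-· g h = begin
      ∑[ i < size ] δ (g · h) (rep i)                      ≈⟨ sum-cong-≋ split ⟩
      ∑[ i < size ] (δ g (rep (act h i)) ∙ δ h (rep i))    ≈⟨ ∑-distrib-+ (λ i → δ g (rep (act h i))) (λ i → δ h (rep i)) ⟩
      (∑[ i < size ] δ g (rep (act h i))) ∙ transfer h     ≈⟨ ∙-congʳ (sum-permute (λ i → δ g (rep i))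
                                                               (Perm.permutation (act h) (act (inv h)) (act-inv′ h) (act-inv h))) ⟨
      transfer g ∙ transfer h                              ∎
      where
      split : ∀ i → δ (g · h) (rep i) ≈ δ g (rep (act h i)) ∙ δ h (rep i)
      split i = begin
        shift ((g · h) · r) ∙ shift r ⁻      ≈⟨ ∙-congʳ (shift-cong (assoc g h r)) ⟩
        shift (g · (h · r)) ∙ shift r ⁻      ≈⟨ ∙-congʳ (≈-trans (∙-congˡ (inverseʳ (shift (h · r)))) (identityʳ _)) ⟨
        (shift (g · (h · r)) ∙ (shift (h · r) ∙ shift (h · r) ⁻)) ∙ shift r ⁻
                                             ≈⟨ solveᶜ 4 (λ a b c d → (a ⊕ (b ⊕ c)) ⊕ d ⊜ᶜ (a ⊕ c) ⊕ (b ⊕ d)) ≈-refl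
                                                 (shift (g · (h · r))) (shift (h · r)) (shift (h · r) ⁻) (shift r ⁻) ⟩
        δ g (h · r) ∙ δ h r                  ≈⟨ ∙-congʳ (δ-rep g (h · r)) ⟨
        δ g (rep (act h i)) ∙ δ h r          ∎
        where r = rep i

    transfer-e : transfer e ≈ ε
    transfer-e = sum-zero λ i → ≈-trans (∙-congʳ (shift-cong (idˡ (rep i)))) (inverseʳ (shift (rep i)))

    transfer-conj : ∀ g a → transfer (conj g a) ≈ transfer a
    transfer-conj g a = begin
      transfer ((g · a) · inv g)                     ≈⟨ transfer-· (g · a) (inv g) ⟩
      transfer (g · a) ∙ transfer (inv g)            ≈⟨ ∙-congʳ (transfer-· g a) ⟩
      (transfer g ∙ transfer a) ∙ transfer (inv g)   ≈⟨ solveᶜ 3 (λ a b c → (a ⊕ b) ⊕ c ⊜ᶜ b ⊕ (a ⊕ c)) ≈-refl (transfer g) (transfer a) (transfer (inv g)) ⟩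
      transfer a ∙ (transfer g ∙ transfer (inv g))   ≈⟨ ∙-congˡ (transfer-· g (inv g)) ⟨
      transfer a ∙ transfer (g · inv g)              ≈⟨ ∙-congˡ (≈-reflexive (cong transfer (invʳ g))) ⟩
      transfer a ∙ transfer e                        ≈⟨ ∙-congˡ transfer-e ⟩
      transfer a ∙ ε                                 ≈⟨ identityʳ _ ⟩
      transfer a                                     ∎

    transfer-comm : ∀ a b → transfer (comm a b) ≈ ε
    transfer-comm a b = begin
      transfer (conj a b · inv b)          ≈⟨ transfer-· (conj a b) (inv b) ⟩
      transfer (conj a b) ∙ transfer (inv b) ≈⟨ ∙-congʳ (transfer-conj a b) ⟩
      transfer b ∙ transfer (inv b)        ≈⟨ transfer-· b (inv b) ⟨
      transfer (b · inv b)                 ≈⟨ ≈-reflexive (cong transfer (invʳ b)) ⟩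
      transfer e                           ≈⟨ transfer-e ⟩
      ε                                    ∎

    module Evaluation {p x} (no-small : NoSmallOrder (suc p)) (Q : Sub G)
      (abelian : ∀ {a b} → a ∈ˢ Q → b ∈ˢ Q → a · b ≡ b · a)
      (exponent : ∀ {a} → a ∈ˢ Q → pow a (suc p) ≡ e)
      (x∈Q : x ∈ˢ Q)
      (Q⊆C : proj₁ Q ⊆ proj₁ C)
      (central : ∀ {c u} → c ∈ˢ C → u ∈ˢ Q → c · u ≡ u · c)
      (conj⊆C⇒∈C : ∀ h → (∀ {u} → u ∈ˢ Q → conj (inv h) u ∈ˢ C) → h ∈ˢ C)
      (exponent-A : ∀ a → ∑[ k < suc p ] a ≈ ε) where

      private
        q = suc p

      period : ∀ {u} → u ∈ˢ Q → ∀ i → iter (act u) q i ≡ i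
      period {u} u∈ i = trans (iter-act u q i) (trans (cong (λ h → act h i) (exponent u∈)) (act-e i))

      -- This is `root∈` for the stabilizer of `i`: if it contains `pow u d`, it contains `u`.
      free : ∀ u i d → 0 < d → d < q → iter (act u) d i ≡ i → act u i ≡ i
      free u i d 0<d d<q eq = ∈⟪⟫⁻ stabilizer? (root∈ no-small stabilizer d u 0<d d<q
        (∈⟪⟫⁺ stabilizer? (trans (sym (iter-act u d i)) eq)))
        where
        stabilizer? : Decidable (λ g → act g i ≡ i)
        stabilizer? g = act g i Finₚ.≟ i
        stabilizer : Sub G
        stabilizer = subgroup stabilizer? (act-e i) λ {a} {b} a∈ b∈ → trans (act-· a b i) (trans (cong (act a) b∈) a∈)

      fixed⇒conj∈ : ∀ {u i} → act u i ≡ i → conj (inv (rep i)) u ∈ˢ C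
      fixed⇒conj∈ {u} {i} eq = subst (_∈ˢ C) (solve 2 (λ u h → h ⁻¹ ⊗ (u ⊗ h) ⊜ conjᵉ (h ⁻¹) u) refl u (rep i))
        (coset-~ (trans (coset-rep i) (sym eq)))

      -- The summands of transfer x, restricted to the cosets fixed by x and by all of us.
      fixedTerm : List (Fin n) → Fin size → Carrier
      fixedTerm []       i = when (act x i Finₚ.≟ i) (δ x (rep i))
      fixedTerm (u ∷ us) i = when (act u i Finₚ.≟ i) (fixedTerm us i)

      act-commute : ∀ {u v} → u ∈ˢ Q → v ∈ˢ Q → ∀ i → act u (act v i) ≡ act v (act u i)
      act-commute {u} {v} u∈ v∈ i = trans (sym (act-· u v i)) (trans (cong (λ g → act g i) (abelian u∈ v∈)) (act-· v u i))

      act-injective : ∀ g {i j} → act g i ≡ act g j → i ≡ j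
      act-injective g {i} {j} eq = trans (sym (act-inv g i)) (trans (cong (act (inv g)) eq) (act-inv g j))

      fixed⁺ : ∀ {u v i} → u ∈ˢ Q → v ∈ˢ Q → act v i ≡ i → act v (act u i) ≡ act u i
      fixed⁺ {u} u∈ v∈ eq = trans (act-commute v∈ u∈ _) (cong (act u) eq)

      fixed⁻ : ∀ {u v i} → u ∈ˢ Q → v ∈ˢ Q → act v (act u i) ≡ act u i → act v i ≡ i
      fixed⁻ {u} u∈ v∈ eq = act-injective u (trans (act-commute u∈ v∈ _) eq)

      -- On a coset fixed by `x` the factor is `φ` of `conj (inv h) x`, and replacing `h` by `u · h`
      -- leaves this conjugate unchanged because `u` commutes with `x`.
      δ-invariant : ∀ {u i} → u ∈ˢ Q → act x i ≡ i → δ x (rep (act u i)) ≈ δ x (rep i)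
      δ-invariant {u} {i} u∈ fixed = begin
        δ x (rep (act u i))      ≈⟨ δ-rep x (u · rep i) ⟩
        δ x (u · rep i)          ≈⟨ δ-fixed x (u · rep i) (subst (_∈ˢ C) (sym eq) (fixed⇒conj∈ fixed)) ⟩
        φ _                      ≈⟨ φ-cong _ _ eq ⟩
        φ (fixed⇒conj∈ fixed)    ≈⟨ δ-fixed x (rep i) (fixed⇒conj∈ fixed) ⟨
        δ x (rep i)              ∎
        where
        eq : conj (inv (u · rep i)) x ≡ conj (inv (rep i)) x
        eq = trans (solve 3 (λ u h x → conjᵉ ((u ⊗ h) ⁻¹) x ⊜ conjᵉ (h ⁻¹) (conjᵉ (u ⁻¹) x)) refl u (rep i) x)
          (cong (conj (inv (rep i))) (commute⇒conj≡ (inv u) x (abelian (inv∈ Q u∈) x∈Q)))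

      fixedTerm-invariant : ∀ {us} → All (_∈ˢ Q) us → ∀ {u} → u ∈ˢ Q → ∀ i → fixedTerm us (act u i) ≈ fixedTerm us i
      fixedTerm-invariant {[]}     []          {u} u∈ i = when-cong (act x (act u i) Finₚ.≟ act u i) (act x i Finₚ.≟ i)
        (fixed⁻ u∈ x∈Q) (fixed⁺ u∈ x∈Q) (λ fixed → δ-invariant u∈ (fixed⁻ u∈ x∈Q fixed))
      fixedTerm-invariant {v ∷ us} (v∈ ∷ us∈)  {u} u∈ i = when-cong (act v (act u i) Finₚ.≟ act u i) (act v i Finₚ.≟ i)
        (fixed⁻ u∈ v∈) (fixed⁺ u∈ v∈) (λ _ → fixedTerm-invariant us∈ u∈ i)

      -- First the orbits of `x`: the factors along a nontrivial one telescope to `ε` because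
      -- `pow x q` is `e`. Then one `u` at a time: the remaining terms are constant on the orbits of
      -- `u`, so a nontrivial orbit contributes a sum of `q` equal terms, which `exponent-A` kills.
      transfer≈sum-fixedTerm : ∀ {us} → All (_∈ˢ Q) us → transfer x ≈ sum (fixedTerm us)
      transfer≈sum-fixedTerm [] = sum-over-fixed-points (act x) (period x∈Q) (free x) (λ i → δ x (rep i)) λ i _ → begin
        ∑[ k < q ] δ x (rep (iter (act x) (toℕ k) i))         ≈⟨ sum-cong-≋ (step i) ⟩
        ∑[ k < q ] (t i (suc (toℕ k)) ∙ t i (toℕ k) ⁻)        ≈⟨ telescope q (t i) ⟩
        t i q ∙ t i 0 ⁻                                       ≈⟨ ∙-congʳ (shift-cong (cong (_· rep i) (exponent x∈Q))) ⟩
        t i 0 ∙ t i 0 ⁻                                       ≈⟨ inverseʳ (t i 0) ⟩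
        ε                                                     ∎
        where
        t : Fin size → ℕ → Carrier
        t i k = shift (pow x k · rep i)

        step : ∀ i (k : Fin q) → δ x (rep (iter (act x) (toℕ k) i)) ≈ t i (suc (toℕ k)) ∙ t i (toℕ k) ⁻
        step i k = begin
          δ x (rep (iter (act x) (toℕ k) i))                ≈⟨ ≈-reflexive (cong (λ j → δ x (rep j)) (iter-act x (toℕ k) i)) ⟩
          δ x (rep (act (pow x (toℕ k)) i))                 ≈⟨ δ-rep x (pow x (toℕ k) · rep i) ⟩
          δ x (pow x (toℕ k) · rep i)                       ≈⟨ ∙-congʳ (shift-cong (sym (assoc x (pow x (toℕ k)) (rep i)))) ⟩
          t i (suc (toℕ k)) ∙ t i (toℕ k) ⁻                 ∎
      transfer≈sum-fixedTerm {u ∷ us} (u∈ ∷ us∈) = ≈-trans (transfer≈sum-fixedTerm us∈)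
        (sum-over-fixed-points (act u) (period u∈) (free u) (fixedTerm us) λ i _ → begin
          ∑[ k < q ] fixedTerm us (iter (act u) (toℕ k) i)  ≈⟨ sum-cong-≋ (step i) ⟩
          ∑[ k < q ] fixedTerm us i                         ≈⟨ exponent-A (fixedTerm us i) ⟩
          ε                                                 ∎)
        where
        step : ∀ i (k : Fin q) → fixedTerm us (iter (act u) (toℕ k) i) ≈ fixedTerm us i
        step i k = ≈-trans (≈-reflexive (cong (fixedTerm us) (iter-act u (toℕ k) i)))
          (fixedTerm-invariant us∈ (pow∈ Q (toℕ k) u∈) i)

      fixedTerm-moved : ∀ {us u i} → u Mem.∈ us → act u i ≢ i → fixedTerm us i ≈ ε
      fixedTerm-moved {u ∷ us} {i = i} (here refl) moved = when-no (act u i Finₚ.≟ i) moved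
      fixedTerm-moved {u ∷ us} {i = i} (there u∈)  moved = when-ε (act u i Finₚ.≟ i) (fixedTerm-moved u∈ moved)

      fixedTerm-fixed : ∀ {us i} → All (_∈ˢ Q) us → (∀ u → u ∈ˢ Q → act u i ≡ i) → fixedTerm us i ≈ δ x (rep i)
      fixedTerm-fixed {i = i} [] fixed = when-yes (act x i Finₚ.≟ i) (fixed x x∈Q)
      fixedTerm-fixed {u ∷ _} {i} (u∈ ∷ us∈) fixed =
        ≈-trans (when-yes (act u i Finₚ.≟ i) (fixed u u∈)) (fixedTerm-fixed us∈ fixed)

      i₀ : Fin size
      i₀ = coset e

      rep-i₀∈C : rep i₀ ∈ˢ C
      rep-i₀∈C = subst (_∈ˢ C) (solve 1 (λ r → (r ⁻¹ ⊗ one) ⁻¹ ⊜ r) refl (rep i₀)) (inv∈ C (rep-coset e))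

      i₀-fixed : ∀ u → u ∈ˢ Q → act u i₀ ≡ i₀
      i₀-fixed u u∈ = coset-cong (subst (_∈ˢ C) (solve 2 (λ u r → (u ⊗ r) ⁻¹ ⊜ (u ⊗ r) ⁻¹ ⊗ one) refl u (rep i₀))
        (inv∈ C (·∈ C (Q⊆C u∈) rep-i₀∈C)))

      -- If all of `Q` fixed the coset `i`, its conjugate by `inv (rep i)` would lie in `C`, and
      -- `conj⊆C⇒∈C` would put `rep i` in `C`.
      moved-elsewhere : ∀ i → i ≢ i₀ → ∃ λ u → u ∈ˢ Q × act u i ≢ i
      moved-elsewhere i i≢i₀ = decidable-stable (any? λ u → (u ∈ˢ? Q) ×-dec ¬? (act u i Finₚ.≟ i)) λ ∄ →
        i≢i₀ (trans (sym (coset-rep i)) (coset-cong (subst (_∈ˢ C) (sym (idʳ _)) (inv∈ C (conj⊆C⇒∈C (rep i) λ {u} u∈ →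
          fixed⇒conj∈ (decidable-stable (act u i Finₚ.≟ i) λ moved → ∄ (u , u∈ , moved)))))))

      -- C itself is the only coset fixed by Q.
      transfer-x : transfer x ≈ φ (Q⊆C x∈Q)
      transfer-x = begin
        transfer x                ≈⟨ transfer≈sum-fixedTerm us∈Q ⟩
        sum (fixedTerm us)        ≈⟨ sum-single i₀ (λ i i≢i₀ → let u , u∈ , moved = moved-elsewhere i i≢i₀ in
                                       fixedTerm-moved (∈-filter⁺ (_∈ˢ? Q) (∈-allFin u) u∈) moved) ⟩
        fixedTerm us i₀           ≈⟨ fixedTerm-fixed us∈Q i₀-fixed ⟩
        δ x (rep i₀)              ≈⟨ δ-fixed x (rep i₀) (fixed⇒conj∈ (i₀-fixed x x∈Q)) ⟩
        φ _                       ≈⟨ φ-cong _ _ (commute⇒conj≡ _ x (central (inv∈ C rep-i₀∈C) x∈Q)) ⟩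
        φ (Q⊆C x∈Q)               ∎
        where
        us = filter (_∈ˢ? Q) (allFin n)
        us∈Q : All (_∈ˢ Q) us
        us∈Q = all-filter (_∈ˢ? Q) (allFin n)

      commutative : Simple → (∀ a → Dec (a ≈ ε)) → ¬ (φ (Q⊆C x∈Q) ≈ ε) → ∀ a b → a · b ≡ b · a
      commutative simple ε? φx≉ε a b =
        [ (λ kernel⊆e → comm≡e⇒commute a b (kernel⊆e (∈⟪⟫⁺ kernel? (transfer-comm a b))))
        , (λ ⊤⊆kernel → contradiction (≈-trans (≈-sym transfer-x) (∈⟪⟫⁻ kernel? (⊤⊆kernel x))) φx≉ε)
        ]′ (simple kernel λ g {a} a∈ → ∈⟪⟫⁺ kernel? (≈-trans (transfer-conj g a) (∈⟪⟫⁻ kernel? a∈)))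
        where
        kernel? : Decidable (λ g → transfer g ≈ ε)
        kernel? g = ε? (transfer g)

        kernel : Sub G
        kernel = subgroup kernel? transfer-e λ {a} {b} a∈ b∈ →
          ≈-trans (transfer-· a b) (≈-trans (∙-cong a∈ b∈) (identityˡ ε))

-- A simple group with a proper subgroup that meets every subgroup maximally is abelian.

module _ {n : ℕ} (G : FinGroup n) where
  open GroupTheory G
  open Maximality G

  module SimpleGroup (M : Sub G)
    (M-max : MeetsMaximally M)
    (simple : Simple)
    {z : Fin n} (z∉M : ¬ (z ∈ˢ M)) where

    -- The intersection of all conjugates of `M` is normal and misses `z`, so simplicity leaves only
    -- the trivial subgroup.
    core-trivial : ∀ x → (∀ g → conj g x ∈ˢ M) → x ≡ e
    core-trivial x x∈core =
      [ (λ J⊆e → J⊆e (∈⟪⟫⁺ core? x∈core))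
      , (λ ⊤⊆J → contradiction (subst (_∈ˢ M) (e-conj z) (∈⟪⟫⁻ core? (⊤⊆J z) e)) z∉M)
      ]′ (simple core λ g {a} a∈ → ∈⟪⟫⁺ core? λ h → subst (_∈ˢ M) (conj-conj h g a) (∈⟪⟫⁻ core? a∈ (h · g)))
      where
      core? : Decidable (λ a → ∀ g → conj g a ∈ˢ M)
      core? a = all? λ g → conj g a ∈ˢ? M
      core : Sub G
      core = subgroup core? (λ g → subst (_∈ˢ M) (sym (conj-e g)) (e∈ M))
        λ {a} {b} a∈ b∈ g → subst (_∈ˢ M) (sym (conj-· g a b)) (·∈ M (a∈ g) (b∈ g))

    -- Stated for bare subsets so that `maximal` can search among them.
    ElementaryAbelian : ℕ → Subset n → Set
    ElementaryAbelian q Q = IsSubgroup G Q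
      × (∀ a → a ∈ Q → ∀ b → b ∈ Q → a · b ≡ b · a)
      × (∀ a → a ∈ Q → pow a q ≡ e)

    elementaryAbelian? : ∀ q → Decidable (ElementaryAbelian q)
    elementaryAbelian? q Q = isSubgroup? Q
      ×-dec (all? λ a → (a ∈? Q) →-dec all? λ b → (b ∈? Q) →-dec ((a · b) Finₚ.≟ (b · a)))
      ×-dec (all? λ a → (a ∈? Q) →-dec (pow a q Finₚ.≟ e))

    cyclic-elementaryAbelian : ∀ {p x} → pow x (suc p) ≡ e → ∃ λ Q → ElementaryAbelian (suc p) Q × x ∈ Q
    cyclic-elementaryAbelian {p} {x} xq≡e = proj₁ X , (proj₂ X , commute , exponent) , power 1 (sym (idʳ x))
      where
      power? : Decidable (λ a → ∃ λ (j : Fin (suc p)) → a ≡ pow x (toℕ j))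
      power? a = any? λ j → a Finₚ.≟ pow x (toℕ j)

      power′ : ∀ k {a} → a ≡ pow x k → ∃ λ (j : Fin (suc p)) → a ≡ pow x (toℕ j)
      power′ k eq = let j , eq′ = pow-Fin {x} {p} xq≡e k in j , trans eq (sym eq′)

      X : Sub G
      X = subgroup power? (zero , refl) λ { (i , refl) (j , refl) → power′ (toℕ i + toℕ j) (sym (pow-+ x (toℕ i) (toℕ j))) }

      power : ∀ k {a} → a ≡ pow x k → a ∈ˢ X
      power k eq = ∈⟪⟫⁺ power? (power′ k eq)

      commute : ∀ a → a ∈ˢ X → ∀ b → b ∈ˢ X → a · b ≡ b · a
      commute a a∈ b b∈ with ∈⟪⟫⁻ power? a∈ | ∈⟪⟫⁻ power? b∈
      ... | i , refl | j , refl = pow-commute (toℕ i) (sym (pow-commute (toℕ j) refl))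

      exponent : ∀ a → a ∈ˢ X → pow a (suc p) ≡ e
      exponent a a∈ with ∈⟪⟫⁻ power? a∈
      ... | j , refl = trans (sym (pow-* x (suc p) (toℕ j)))
        (trans (cong (pow x) (ℕₚ.*-comm (suc p) (toℕ j))) (pow-*≡e (toℕ j) xq≡e))

    module _ {p x} (no-small : NoSmallOrder (suc p)) (x∉M : ¬ (x ∈ˢ M)) (Q : Sub G)
      (Q-elementary : ElementaryAbelian (suc p) (proj₁ Q)) (x∈Q : x ∈ˢ Q)
      (Q-maximal : ∀ U → ElementaryAbelian (suc p) U → proj₁ Q ⊆ U → U ⊆ proj₁ Q) where

      private
        q = suc p

        abelian : ∀ {a b} → a ∈ˢ Q → b ∈ˢ Q → a · b ≡ b · a
        abelian a∈ b∈ = proj₁ (proj₂ Q-elementary) _ a∈ _ b∈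

        exponent : ∀ {a} → a ∈ˢ Q → pow a q ≡ e
        exponent = proj₂ (proj₂ Q-elementary) _

        -- Defined as the normalizer; `central` shows that it is also the centralizer of `Q`.
        C : Sub G
        C = normalizer Q

        opaque
          Q⊆C : proj₁ Q ⊆ proj₁ C
          Q⊆C = ⊆-normalizer Q

          -- [C, Q] lies in every conjugate of M.
          central : ∀ {c u} → c ∈ˢ C → u ∈ˢ Q → c · u ≡ u · c
          central {c} {u} c∈ u∈ = comm≡e⇒commute c u (core-trivial _ λ g →
            subst (λ h → conj h (comm c u) ∈ˢ M) (inv-inv g) (∈⟪⟫⁻ (conjugate? (inv g) M)
              (normalizer-comm∈ no-small Q abelian exponent {conjugate (inv g) M}
                (conjugate-meetsMaximally (inv g) {M} M-max) c∈ u∈)))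

          -- The element `x` is outside `M` and central in `C`, so it satisfies the property
          -- trivially; elements of `C` inside `M` satisfy it too, and `fill` does the rest.
          normal : ∀ {c m} → c ∈ˢ C → m ∈ˢ C → m ∈ˢ M → conj c m ∈ˢ M
          normal c∈ = fill {M} M-max C (λ c → all? λ m → (m ∈ˢ? C) →-dec ((m ∈ˢ? M) →-dec (conj c m ∈ˢ? M)))
            (λ m _ m∈M → subst (_∈ˢ M) (sym (e-conj m)) m∈M)
            (λ {a} {b} _ b∈ pa pb m m∈C m∈M → subst (_∈ˢ M) (sym (conj-conj a b m)) (pa _ (conj∈ C b∈ m∈C) (pb m m∈C m∈M)))
            (λ c∈M _ m _ m∈M → conj∈ M c∈M m∈M)
            (Q⊆C x∈Q) (λ m m∈C m∈M → subst (_∈ˢ M) (sym (commute⇒conj≡ x m (sym (central m∈C x∈Q)))) m∈M) x∉M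
            c∈ _

          -- For fixed `d`, the elements `c` with `comm c d` in `M` are closed under products by
          -- `normal`. They include `x`, which is central in `C`, and the elements of `C` inside
          -- `M`.
          comm∈M : ∀ {c d} → c ∈ˢ C → d ∈ˢ C → comm c d ∈ˢ M
          comm∈M {d = d} c∈ d∈ = fill {M} M-max C (λ c → comm c d ∈ˢ? M)
            (subst (_∈ˢ M) (sym (comm-eˡ d)) (e∈ M))
            (λ {a} {b} a∈ b∈ pa pb → subst (_∈ˢ M) (sym (comm-·ˡ a b d)) (·∈ M (normal a∈ (comm∈ C b∈ d∈) pb) pa))
            (λ {m} m∈M m∈C → subst (_∈ˢ M) (solve 2 (λ m d → m ⊗ conjᵉ d (m ⁻¹) ⊜ commᵉ m d) refl m d)
              (·∈ M m∈M (normal d∈ (inv∈ C m∈C) (inv∈ M m∈M))))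
            (Q⊆C x∈Q) (subst (_∈ˢ M) (sym (commute⇒comm≡e x d (sym (central d∈ x∈Q)))) (e∈ M)) x∉M
            c∈

          -- By `cyclic-quotient`, `c` is a power of `x` times an element of `M`. The power of `x`
          -- is central in `C` and disappears in the `q`-th power.
          pow∈M : ∀ {c} → c ∈ˢ C → pow c q ∈ˢ M
          pow∈M {c} c∈ = subst (_∈ˢ M) (sym (begin
            pow c q                              ≡⟨ cong (λ a → pow a q) (cancelˡ′ v c) ⟨
            pow (v · (inv v · c)) q              ≡⟨ pow-· q (sym (central (·∈ C (inv∈ C (Q⊆C v∈Q)) c∈) v∈Q)) ⟩
            pow v q · pow (inv v · c) q          ≡⟨ cong (_· pow (inv v · c) q) (exponent v∈Q) ⟩
            e · pow (inv v · c) q                ≡⟨ idˡ _ ⟩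
            pow (inv v · c) q                    ∎)) (pow∈ M q (proj₂ decomposition))
            where
            open ≡-Reasoning
            decomposition : ∃ λ (j : Fin q) → (inv (pow x (toℕ j)) · c) ∈ˢ M
            decomposition = cyclic-quotient {M} M-max C (Q⊆C x∈Q) x∉M (λ y∈ → sym (central y∈ x∈Q)) (exponent x∈Q) c∈
            v : Fin n
            v = pow x (toℕ (proj₁ decomposition))
            v∈Q : v ∈ˢ Q
            v∈Q = pow∈ Q (toℕ (proj₁ decomposition)) x∈Q

          -- Q commutes with its conjugate by h⁻¹, and together they span an elementary abelian group.
          conj⊆C⇒∈C : ∀ h → (∀ {u} → u ∈ˢ Q → conj (inv h) u ∈ˢ C) → h ∈ˢ C
          -- Maximality of `Q` gives that `W` lies in `Q`, hence so does every `γ u`: thus `inv h`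
          -- normalizes `Q`, and therefore `h` does.
          conj⊆C⇒∈C h γ∈C = subst (_∈ˢ C) (inv-inv h) (inv∈ C (∈⟪⟫⁺ (normalizes? Q) λ u u∈ →
            Q-maximal (proj₁ W) (proj₂ W , W-abelian , W-exponent) Q⊆W
              (∈⟪⟫⁺ W? (e , u , e∈ Q , u∈ , sym (idˡ _)))))
            where
            γ : Fin n → Fin n
            γ = conj (inv h)

            InW : Fin n → Set
            InW w = ∃ λ u → ∃ λ v → u ∈ˢ Q × v ∈ˢ Q × w ≡ u · γ v

            W? : Decidable InW
            W? w = any? λ u → any? λ v → (u ∈ˢ? Q) ×-dec (v ∈ˢ? Q) ×-dec (w Finₚ.≟ (u · γ v))

            open ≡-Reasoning

            product : ∀ {u v u′ v′} → v ∈ˢ Q → u′ ∈ˢ Q → (u · γ v) · (u′ · γ v′) ≡ (u · u′) · γ (v · v′)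
            product {u} {v} {u′} {v′} v∈ u′∈ = begin
              (u · γ v) · (u′ · γ v′)   ≡⟨ solve 4 (λ a b c d → (a ⊗ b) ⊗ (c ⊗ d) ⊜ (a ⊗ (b ⊗ c)) ⊗ d) refl u (γ v) u′ (γ v′) ⟩
              (u · (γ v · u′)) · γ v′   ≡⟨ cong (λ w → (u · w) · γ v′) (central (γ∈C v∈) u′∈) ⟩
              (u · (u′ · γ v)) · γ v′   ≡⟨ solve 4 (λ a b c d → (a ⊗ (c ⊗ b)) ⊗ d ⊜ (a ⊗ c) ⊗ (b ⊗ d)) refl u (γ v) u′ (γ v′) ⟩
              (u · u′) · (γ v · γ v′)   ≡⟨ cong ((u · u′) ·_) (conj-· (inv h) v v′) ⟨
              (u · u′) · γ (v · v′)     ∎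

            W : Sub G
            W = subgroup W? (e , e , e∈ Q , e∈ Q , sym (trans (idˡ _) (conj-e (inv h))))
              λ { (u , v , u∈ , v∈ , refl) (u′ , v′ , u′∈ , v′∈ , refl) →
                  u · u′ , v · v′ , ·∈ Q u∈ u′∈ , ·∈ Q v∈ v′∈ , product v∈ u′∈ }

            Q⊆W : proj₁ Q ⊆ proj₁ W
            Q⊆W {u} u∈ = ∈⟪⟫⁺ W? (u , e , u∈ , e∈ Q , sym (trans (cong (u ·_) (conj-e (inv h))) (idʳ u)))

            W-abelian : ∀ a → a ∈ˢ W → ∀ b → b ∈ˢ W → a · b ≡ b · a
            W-abelian a a∈ b b∈ = commute (∈⟪⟫⁻ W? a∈) (∈⟪⟫⁻ W? b∈)
              where
              commute : ∀ {a b} → InW a → InW b → a · b ≡ b · a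
              commute (u , v , u∈ , v∈ , refl) (u′ , v′ , u′∈ , v′∈ , refl) = trans (product v∈ u′∈)
                (trans (cong₂ (λ s t → s · γ t) (abelian u∈ u′∈) (abelian v∈ v′∈)) (sym (product v′∈ u∈)))

            W-exponent : ∀ a → a ∈ˢ W → pow a q ≡ e
            W-exponent a a∈ = power (∈⟪⟫⁻ W? a∈)
              where
              power : ∀ {a} → InW a → pow a q ≡ e
              power (u , v , u∈ , v∈ , refl) = begin
                pow (u · γ v) q       ≡⟨ pow-· q (sym (central (γ∈C v∈) u∈)) ⟩
                pow u q · pow (γ v) q ≡⟨ cong₂ _·_ (exponent u∈) (trans (sym (conj-pow (inv h) v q)) (trans (cong γ (exponent v∈)) (conj-e (inv h)))) ⟩
                e · e                 ≡⟨ idˡ e ⟩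
                e                     ∎

        -- Wrapping the membership in a record lets `a` and `b` be inferred from the type of an
        -- equation.
        record _≡ᴹ_ (a b : Σ (Fin n) (_∈ˢ C)) : Set where
          constructor mod-M
          field quotient∈ : (inv (proj₁ a) · proj₁ b) ∈ˢ M
        open _≡ᴹ_

        ≡⇒≈ : ∀ {a b} → proj₁ a ≡ proj₁ b → a ≡ᴹ b
        ≡⇒≈ {a} {b} eq = mod-M (subst (_∈ˢ M) (sym (trans (cong (inv (proj₁ a) ·_) (sym eq)) (invˡ _))) (e∈ M))

        -- The abelian group C / (C ∩ M).
        C/M : AbelianGroup 0ℓ 0ℓ
        C/M = record
          { Carrier = Σ (Fin n) (_∈ˢ C)
          ; _≈_ = _≡ᴹ_
          ; _∙_ = λ (a , a∈) (b , b∈) → a · b , ·∈ C a∈ b∈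
          ; ε = e , e∈ C
          ; _⁻¹ = λ (a , a∈) → inv a , inv∈ C a∈
          ; isAbelianGroup = record
            { isGroup = record
              { isMonoid = record
                { isSemigroup = record
                  { isMagma = record
                    { isEquivalence = record
                      { refl = ≡⇒≈ refl
                      ; sym = λ {a} {b} (mod-M ab∈) → mod-M (subst (_∈ˢ M)
                          (solve 2 (λ a b → (a ⁻¹ ⊗ b) ⁻¹ ⊜ b ⁻¹ ⊗ a) refl (proj₁ a) (proj₁ b)) (inv∈ M ab∈))
                      ; trans = λ {a} {b} {c} (mod-M ab∈) (mod-M bc∈) → mod-M (subst (_∈ˢ M)
                          (solve 3 (λ a b c → (a ⁻¹ ⊗ b) ⊗ (b ⁻¹ ⊗ c) ⊜ a ⁻¹ ⊗ c) refl (proj₁ a) (proj₁ b) (proj₁ c)) (·∈ M ab∈ bc∈))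
                      }
                    ; ∙-cong = λ { {a , a∈} {a′ , a′∈} {b , b∈} {b′ , b′∈} (mod-M aa′∈) (mod-M bb′∈) → mod-M (subst (_∈ˢ M)
                        (solve 4 (λ a a′ b b′ → conjᵉ (b ⁻¹) (a ⁻¹ ⊗ a′) ⊗ (b ⁻¹ ⊗ b′) ⊜ (a ⊗ b) ⁻¹ ⊗ (a′ ⊗ b′)) refl a a′ b b′)
                        (·∈ M (normal (inv∈ C b∈) (·∈ C (inv∈ C a∈) a′∈) aa′∈) bb′∈)) }
                    }
                  ; assoc = λ _ _ _ → ≡⇒≈ (assoc _ _ _)
                  }
                ; identity = (λ _ → ≡⇒≈ (idˡ _)) , (λ _ → ≡⇒≈ (idʳ _))
                }
              ; inverse = (λ _ → ≡⇒≈ (invˡ _)) , (λ _ → ≡⇒≈ (invʳ _))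
              ; ⁻¹-cong = λ { {a , a∈} {b , b∈} (mod-M ab∈) → mod-M (subst (_∈ˢ M)
                  (solve 2 (λ a b → conjᵉ a ((a ⁻¹ ⊗ b) ⁻¹) ⊜ a ⁻¹ ⁻¹ ⊗ b ⁻¹) refl a b)
                  (normal a∈ (inv∈ C (·∈ C (inv∈ C a∈) b∈)) (inv∈ M ab∈))) }
              }
            ; comm = λ (a , a∈) (b , b∈) → mod-M (subst (_∈ˢ M)
                (solve 2 (λ a b → commᵉ (b ⁻¹) (a ⁻¹) ⊜ (a ⊗ b) ⁻¹ ⊗ (b ⊗ a)) refl a b)
                (comm∈M (inv∈ C b∈) (inv∈ C a∈)))
            }
          }

        open AbelianGroup C/M using (_≈_; ε) renaming (refl to ≈-refl; sym to ≈-sym)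
        open Sum (AbelianGroup.commutativeMonoid C/M) using (sum-syntax)

        exponent-C/M : ∀ a → ∑[ k < q ] a ≈ ε
        exponent-C/M (a , a∈) = ≈-sym (mod-M (subst (_∈ˢ M) (sym (trans (cong (_· power q) inv-e) (trans (idˡ _) (power≡ q)))) (pow∈M a∈)))
          where
          power : ℕ → Fin n
          power m = proj₁ (∑[ k < m ] (a , a∈))
          power≡ : ∀ m → power m ≡ pow a m
          power≡ zero = refl
          power≡ (suc m) = cong (a ·_) (power≡ m)

        φ : ∀ {c} → c ∈ˢ C → Σ (Fin n) (_∈ˢ C)
        φ {c} c∈ = c , c∈

        C/M≈ε? : ∀ a → Dec (a ≈ ε)
        C/M≈ε? (a , _) = map′ mod-M quotient∈ ((inv a · e) ∈ˢ? M)

        φx≉ε : ¬ (φ (Q⊆C x∈Q) ≈ ε)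
        φx≉ε (mod-M xe∈) = x∉M (subst (_∈ˢ M) (solve 1 (λ x → (x ⁻¹ ⊗ one) ⁻¹ ⊜ x) refl x) (inv∈ M xe∈))

      commutative-of-Q : ∀ a b → a · b ≡ b · a
      commutative-of-Q = Transfer.Evaluation.commutative G C/M C φ (λ _ _ → ≡⇒≈) (λ _ _ → ≈-refl)
        no-small Q abelian exponent x∈Q Q⊆C central conj⊆C⇒∈C exponent-C/M simple C/M≈ε? φx≉ε

    commutative : ∀ a b → a · b ≡ b · a
    commutative
      with torsion z
    ... | d₀ , 0<d₀ , zd₀≡e
      -- Here `suc p` becomes the least positive exponent that kills some nontrivial element. The
      -- search starts from `z`, which is nontrivial because it lies outside `M`.
      with least (λ d → (0 ℕₚ.<? d) ×-dec any? λ x → ¬? (x Finₚ.≟ e) ×-dec (pow x d Finₚ.≟ e))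
             d₀ (0<d₀ , z , (λ z≡e → z∉M (subst (_∈ˢ M) (sym z≡e) (e∈ M))) , zd₀≡e)
    ... | suc p , (_ , y , y≢e , yq≡e) , min
      -- If every conjugate of `y` were in `M`, `core-trivial` would make `y` trivial. The conjugate
      -- outside `M` plays the part of `x`; its `suc p`-th power is again `e`.
      with Finₚ.¬∀⟶∃¬ n (λ g → conj g y ∈ˢ M) (λ g → conj g y ∈ˢ? M) (y≢e ∘ core-trivial y)
    ... | g , x∉M
      with cyclic-elementaryAbelian {p} (trans (sym (conj-pow g y (suc p))) (trans (cong (conj g) yq≡e) (conj-e g)))
    ... | Q₀ , Q₀-elementary , x∈Q₀
      with maximal (elementaryAbelian? (suc p)) Q₀ Q₀-elementary
    ... | Q , Q-elementary , Q₀⊆Q , Q-maximal =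
      commutative-of-Q no-small x∉M (Q , proj₁ Q-elementary) Q-elementary (Q₀⊆Q x∈Q₀) Q-maximal
      where
      no-small : NoSmallOrder (suc p)
      no-small d x 0<d d<q eq = decidable-stable (x Finₚ.≟ e) λ x≢e → min d d<q (0<d , x , x≢e , eq)

-- Quotient groups and the correspondence of subgroups.

module _ {n : ℕ} (G : FinGroup n) where
  open GroupTheory G

  module Quotient (K N : Sub G)
    (normal : ∀ {k h} → k ∈ˢ K → h ∈ˢ N → conj k h ∈ˢ N) where

    _~_ : Rel (Fin n) 0ℓ
    x ~ y = (inv x · y) ∈ˢ N

    ~-isDecEquivalence : IsDecEquivalence _~_
    ~-isDecEquivalence = leftCoset-isDecEquivalence N
    open IsDecEquivalence ~-isDecEquivalence using () renaming (refl to ~-refl; sym to ~-sym; trans to ~-trans)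

    ~-· : ∀ {x x′ y y′} → y ∈ˢ K → x ~ x′ → y ~ y′ → (x · y) ~ (x′ · y′)
    ~-· {x} {x′} {y} {y′} y∈ x~x′ y~y′ = subst (_∈ˢ N)
      (solve 4 (λ x x′ y y′ → conjᵉ (y ⁻¹) (x ⁻¹ ⊗ x′) ⊗ (y ⁻¹ ⊗ y′) ⊜ (x ⊗ y) ⁻¹ ⊗ (x′ ⊗ y′)) refl x x′ y y′)
      (·∈ N (normal (inv∈ K y∈) x~x′) y~y′)

    open Classes (classes (_∈ˢ? K) ~-isDecEquivalence) public using (size; rep) renaming (rep∈ to rep∈K)
    open Classes (classes (_∈ˢ? K) ~-isDecEquivalence) using (cls; rep-cls; rep-unique)

    π : ∀ {x} → x ∈ˢ K → Fin size
    π = cls _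

    rep-π : ∀ {x} (x∈ : x ∈ˢ K) → rep (π x∈) ~ x
    rep-π = rep-cls _

    π-cong : ∀ {x y} (x∈ : x ∈ˢ K) (y∈ : y ∈ˢ K) → x ~ y → π x∈ ≡ π y∈
    π-cong x∈ y∈ x~y = rep-unique _ _ (~-trans (rep-π x∈) (~-trans x~y (~-sym (rep-π y∈))))

    π-≡ : ∀ {x y} (x∈ : x ∈ˢ K) (y∈ : y ∈ˢ K) → x ≡ y → π x∈ ≡ π y∈
    π-≡ x∈ y∈ refl = π-cong x∈ y∈ ~-refl

    π-reflects : ∀ {x y} (x∈ : x ∈ˢ K) (y∈ : y ∈ˢ K) → π x∈ ≡ π y∈ → x ~ y
    π-reflects {y = y} x∈ y∈ eq = ~-trans (~-sym (rep-π x∈)) (subst (λ i → rep i ~ y) (sym eq) (rep-π y∈))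

    π-rep : ∀ i → π (rep∈K i) ≡ i
    π-rep i = rep-unique _ _ (rep-π (rep∈K i))

    infixl 7 _⋆_
    _⋆_ : Fin size → Fin size → Fin size
    i ⋆ j = π (·∈ K (rep∈K i) (rep∈K j))

    π-· : ∀ {x y} (x∈ : x ∈ˢ K) (y∈ : y ∈ˢ K) → π x∈ ⋆ π y∈ ≡ π (·∈ K x∈ y∈)
    π-· x∈ y∈ = π-cong _ _ (~-· (rep∈K _) (rep-π x∈) (rep-π y∈))

    ⋆-π : ∀ i {y} (y∈ : y ∈ˢ K) → i ⋆ π y∈ ≡ π (·∈ K (rep∈K i) y∈)
    ⋆-π i y∈ = trans (cong (_⋆ π y∈) (sym (π-rep i))) (π-· (rep∈K i) y∈)

    π-⋆ : ∀ {x} (x∈ : x ∈ˢ K) j → π x∈ ⋆ j ≡ π (·∈ K x∈ (rep∈K j))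
    π-⋆ x∈ j = trans (cong (π x∈ ⋆_) (sym (π-rep j))) (π-· x∈ (rep∈K j))

    quotient : FinGroup size
    quotient = record
      { _·_ = _⋆_
      ; e = π (e∈ K)
      ; inv = λ i → π (inv∈ K (rep∈K i))
      ; assoc = λ i j k → trans (π-⋆ _ k) (trans (π-≡ _ _ (assoc _ _ _)) (sym (⋆-π i _)))
      ; idˡ = λ i → trans (π-⋆ (e∈ K) i) (trans (π-≡ _ (rep∈K i) (idˡ _)) (π-rep i))
      ; idʳ = λ i → trans (⋆-π i (e∈ K)) (trans (π-≡ _ (rep∈K i) (idʳ _)) (π-rep i))
      ; invˡ = λ i → trans (π-⋆ _ i) (π-≡ _ _ (invˡ _))
      ; invʳ = λ i → trans (⋆-π i _) (π-≡ _ _ (invʳ _))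
      }

    π-conj : ∀ {k h} (k∈ : k ∈ˢ K) (h∈ : h ∈ˢ K) → GroupTheory.conj quotient (π k∈) (π h∈) ≡ π (conj∈ K k∈ h∈)
    π-conj k∈ h∈ = trans (cong₂ _⋆_ (π-· k∈ h∈) (π-cong _ (inv∈ K k∈) (~-inv k∈))) (π-· _ _)
      where
      ~-inv : ∀ {k} (k∈ : k ∈ˢ K) → inv (rep (π k∈)) ~ inv k
      ~-inv {k} k∈ = subst (_∈ˢ N)
        (solve 2 (λ r k → conjᵉ k ((r ⁻¹ ⊗ k) ⁻¹) ⊜ (r ⁻¹) ⁻¹ ⊗ k ⁻¹) refl (rep (π k∈)) k)
        (normal k∈ (inv∈ N (rep-π k∈)))

    preimage? : ∀ (Y : Subset size) → Decidable (λ x → Σ (x ∈ˢ K) λ x∈ → π x∈ ∈ Y)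
    preimage? Y x with x ∈ˢ? K
    ... | no x∉ = no (x∉ ∘ proj₁)
    ... | yes x∈ = map′ (x∈ ,_) (λ (x∈′ , πx∈) → subst (_∈ Y) (π-≡ x∈′ x∈ refl) πx∈) (π x∈ ∈? Y)

    preimage : Sub quotient → Sub G
    preimage (Y , e∈Y , ·∈Y , _) = subgroup (preimage? Y) (e∈ K , e∈Y)
      λ (a∈ , πa∈) (b∈ , πb∈) → ·∈ K a∈ b∈ , subst (_∈ Y) (π-· a∈ b∈) (·∈Y πa∈ πb∈)

    preimage⁻ : ∀ Y {x} → x ∈ˢ preimage Y → Σ (x ∈ˢ K) λ x∈ → π x∈ ∈ proj₁ Y
    preimage⁻ (Y , _) = ∈⟪⟫⁻ (preimage? Y)

    preimage⁺ : ∀ Y {x} (x∈ : x ∈ˢ K) → π x∈ ∈ proj₁ Y → x ∈ˢ preimage Y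
    preimage⁺ (Y , _) x∈ πx∈ = ∈⟪⟫⁺ (preimage? Y) (x∈ , πx∈)

    rep∈preimage : ∀ Y {i} → i ∈ proj₁ Y → rep i ∈ˢ preimage Y
    rep∈preimage Y {i} i∈ = preimage⁺ Y (rep∈K i) (subst (_∈ proj₁ Y) (sym (π-rep i)) i∈)

    rep∈preimage⁻ : ∀ Y {i} → rep i ∈ˢ preimage Y → i ∈ proj₁ Y
    rep∈preimage⁻ Y {i} r∈ = let x∈ , πx∈ = preimage⁻ Y r∈ in
      subst (_∈ proj₁ Y) (trans (π-≡ x∈ (rep∈K i) refl) (π-rep i)) πx∈

    module _ (N⊆K : proj₁ N ⊆ proj₁ K) where

      N⊆preimage : ∀ Y → proj₁ N ⊆ proj₁ (preimage Y)
      N⊆preimage Y {x} x∈N = preimage⁺ Y (N⊆K x∈N) (subst (_∈ proj₁ Y)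
        (π-cong (e∈ K) (N⊆K x∈N) (subst (_∈ˢ N) (solve 1 (λ x → x ⊜ one ⁻¹ ⊗ x) refl x) x∈N)) (proj₁ (proj₂ Y)))

      module _ (M : Sub G) (N⊆M : proj₁ N ⊆ proj₁ M) where

        -- Containing `N`, the subgroup `M` is a union of cosets, so membership can be tested on
        -- representatives.
        ~-∈ : ∀ {x y} → x ~ y → x ∈ˢ M → y ∈ˢ M
        ~-∈ {x} {y} x~y x∈M = subst (_∈ˢ M) (cancelˡ′ x y) (·∈ M x∈M (N⊆M x~y))

        image? : Decidable (λ i → rep i ∈ˢ M)
        image? i = rep i ∈ˢ? M

        image : Sub quotient
        image = GroupTheory.subgroup quotient image? (~-∈ (~-sym (rep-π (e∈ K))) (e∈ M))
          λ a∈ b∈ → ~-∈ (~-sym (rep-π _)) (·∈ M a∈ b∈)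

        -- Taking preimages turns subgroups of the quotient into subgroups between `N` and `K`,
        -- where the hypothesis applies.
        image-meetsMaximally :
          (∀ (X Y : Sub G) → proj₁ N ⊆ proj₁ X → proj₁ X ⊆ proj₁ Y → proj₁ Y ⊆ proj₁ K →
            (∀ {a} → a ∈ˢ M → a ∈ˢ Y → a ∈ˢ X) → (proj₁ X ⊆ proj₁ M) ⊎ (proj₁ Y ⊆ proj₁ X)) →
          Maximality.MeetsMaximally quotient image
        image-meetsMaximally M-max X Y X⊆Y MY⊆X =
          [ (λ X⊆M → inj₁ λ {i} i∈X → ∈⟪⟫⁺ image? (X⊆M (rep∈preimage X i∈X)))
          , (λ Y⊆X → inj₂ λ {i} i∈Y → rep∈preimage⁻ X (Y⊆X (rep∈preimage Y i∈Y)))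
          ]′ (M-max (preimage X) (preimage Y) (N⊆preimage X)
               (λ x∈ → let x∈K , πx∈ = preimage⁻ X x∈ in preimage⁺ Y x∈K (X⊆Y πx∈))
               (λ x∈ → proj₁ (preimage⁻ Y x∈))
               (λ a∈M a∈Y → let a∈K , πa∈ = preimage⁻ Y a∈Y in
                 preimage⁺ X a∈K (MY⊆X (∈⟪⟫⁺ image? (~-∈ (~-sym (rep-π a∈K)) a∈M)) πa∈)))

-- Chains of abelian steps, extended downwards from the whole group.

data Series {n : ℕ} (G : FinGroup n) : Subset n → Set where
  top  : Series G ⊤
  step : ∀ {H K} → IsSubgroup G H → NormalAbelianStep G H K → Series G K → Series G H

module _ {n : ℕ} (G : FinGroup n) where
  open GroupTheory G

  ⊤-isSubgroup : IsSubgroup G ⊤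
  ⊤-isSubgroup = ∈⊤ , (λ _ _ → ∈⊤) , (λ _ → ∈⊤)

  ⁅e⁆-isSubgroup : IsSubgroup G ⁅ e ⁆
  ⁅e⁆-isSubgroup = x∈⁅x⁆ e
    , (λ a∈ b∈ → subst (_∈ ⁅ e ⁆) (sym (trans (cong₂ _·_ (x∈⁅y⁆⇒x≡y e a∈) (x∈⁅y⁆⇒x≡y e b∈)) (idˡ e))) (x∈⁅x⁆ e))
    , (λ a∈ → subst (_∈ ⁅ e ⁆) (sym (trans (cong inv (x∈⁅y⁆⇒x≡y e a∈)) inv-e)) (x∈⁅x⁆ e))

  series⇒solvable : Series G ⁅ e ⁆ → Solvable G
  series⇒solvable = chain
    where
    chain : ∀ {H} → Series G H → Σ ℕ λ k → Σ (Fin (suc k) → Subset n) λ S →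
      (∀ i → IsSubgroup G (S i)) × (S zero ≡ H) × (S (Fin.fromℕ k) ≡ ⊤)
      × (∀ (i : Fin k) → NormalAbelianStep G (S (Fin.inject₁ i)) (S (suc i)))
    chain top = 0 , (λ _ → ⊤) , (λ _ → ⊤-isSubgroup) , refl , refl , λ ()
    chain {H} (step H-sub H⊲K series) with chain series
    ... | k , S , S-sub , refl , S-top , S-step = suc k
      , (λ { zero → H ; (suc i) → S i })
      , (λ { zero → H-sub ; (suc i) → S-sub i })
      , refl , S-top
      , (λ { zero → H⊲K ; (suc i) → S-step i })

  solvable⇒series : Solvable G → Series G ⁅ e ⁆
  solvable⇒series (k , S , S-sub , S-bottom , S-top , S-step) = subst (Series G) S-bottom (unchain k S S-sub S-top S-step)
    where
    unchain : ∀ k (S : Fin (suc k) → Subset n) → (∀ i → IsSubgroup G (S i)) → S (Fin.fromℕ k) ≡ ⊤ →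
      (∀ (i : Fin k) → NormalAbelianStep G (S (Fin.inject₁ i)) (S (suc i))) → Series G (S zero)
    unchain zero    S S-sub S-top S-step = subst (Series G) (sym S-top) top
    unchain (suc k) S S-sub S-top S-step =
      step (S-sub zero) (S-step zero) (unchain k (S ∘ suc) (S-sub ∘ suc) S-top (S-step ∘ suc))

  -- Left-modular coatoms, maximal normal subgroups and the descent to the trivial group.

  intersection? : ∀ (S T : Sub G) → Decidable (λ x → x ∈ˢ S × x ∈ˢ T)
  intersection? S T x = (x ∈ˢ? S) ×-dec (x ∈ˢ? T)

  intersection : Sub G → Sub G → Sub G
  intersection S T = subgroup (intersection? S T) (e∈ S , e∈ T)
    λ (a∈S , a∈T) (b∈S , b∈T) → ·∈ S a∈S b∈S , ·∈ T a∈T b∈T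

  intersection⁺ : ∀ S T {x} → x ∈ˢ S → x ∈ˢ T → x ∈ˢ intersection S T
  intersection⁺ S T x∈S x∈T = ∈⟪⟫⁺ (intersection? S T) (x∈S , x∈T)

  intersection⁻ : ∀ S T {x} → x ∈ˢ intersection S T → x ∈ˢ S × x ∈ˢ T
  intersection⁻ S T = ∈⟪⟫⁻ (intersection? S T)

  -- An upper bound `K` of `x` and `m` may stick out of `v`, so the coatom property is applied to
  -- its intersection with `v`.
  coatom-join : ∀ {u v m x} → CoatomOf G u v m → proj₁ x ⊆ proj₁ v → ¬ (proj₁ x ⊆ proj₁ m) → IsJoin G x m v
  coatom-join {v = v} {m} {x} ((_ , m⊆v) , _ , coatom) x⊆v x⊈m = x⊆v , m⊆v , λ K x⊆K m⊆K →
    [ (λ eq → contradiction (λ {a} a∈x → subst (a ∈_) eq (intersection⁺ K v (x⊆K a∈x) (x⊆v a∈x))) x⊈m)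
    , (λ eq {a} a∈v → proj₁ (intersection⁻ K v (subst (a ∈_) (sym eq) a∈v)))
    ]′ (coatom (intersection K v) (λ a∈m → intersection⁺ K v (m⊆K a∈m) (m⊆v a∈m)) (λ a∈ → proj₂ (intersection⁻ K v a∈)))

  -- If `X` is not below `m`, its join with `m` is `v`. For `X` strictly below `Y` the left side of
  -- the modular equation is then `Y`, while the right side is `X` because the meet of `m` and `Y`
  -- lies in `X`.
  leftModular-meetsMaximally : ∀ {u v m} → CoatomOf G u v m → LeftModularIn G u v m →
    ∀ (X Y : Sub G) → proj₁ u ⊆ proj₁ X → proj₁ X ⊆ proj₁ Y → proj₁ Y ⊆ proj₁ v →
    (∀ {a} → a ∈ˢ m → a ∈ˢ Y → a ∈ˢ X) → (proj₁ X ⊆ proj₁ m) ⊎ (proj₁ Y ⊆ proj₁ X)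
  leftModular-meetsMaximally {u} {v} {m} m-coatom m-modular X Y u⊆X X⊆Y Y⊆v mY⊆X
    with proj₁ X ⊆? proj₁ m | proj₁ Y ⊆? proj₁ X
  ... | yes X⊆m | _ = inj₁ X⊆m
  ... | no X⊈m | yes Y⊆X = inj₂ Y⊆X
  ... | no X⊈m | no Y⊈X = contradiction (λ {a} a∈Y → subst (a ∈_) Y≡X a∈Y) Y⊈X
    where
    Y≡X : proj₁ Y ≡ proj₁ X
    Y≡X = m-modular X Y (u⊆X , λ a∈X → Y⊆v (X⊆Y a∈X)) ((λ a∈u → X⊆Y (u⊆X a∈u)) , Y⊆v)
      (X⊆Y , λ eq → Y⊈X λ {a} a∈Y → subst (a ∈_) (sym eq) a∈Y)
      v Y (intersection m Y) X
      (coatom-join {u} {v} {m} {X} m-coatom (λ a∈X → Y⊆v (X⊆Y a∈X)) X⊈m)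
      (Y⊆v , (λ a∈ → a∈) , λ K K⊆v K⊆Y → K⊆Y)
      ((λ a∈ → proj₁ (intersection⁻ m Y a∈)) , (λ a∈ → proj₂ (intersection⁻ m Y a∈))
        , λ K K⊆m K⊆Y a∈ → intersection⁺ m Y (K⊆m a∈) (K⊆Y a∈))
      ((λ a∈ → a∈) , (λ a∈ → let a∈m , a∈Y = intersection⁻ m Y a∈ in mY⊆X a∈m a∈Y) , λ K X⊆K _ → X⊆K)

  NormalIn : Subset n → Subset n → Set
  NormalIn S K = ∀ k → k ∈ K → ∀ h → h ∈ S → conj k h ∈ S

  normalIn? : ∀ S K → Dec (NormalIn S K)
  normalIn? S K = all? λ k → (k ∈? K) →-dec all? λ h → (h ∈? S) →-dec (conj k h ∈? S)

  ProperNormal : Subset n → Subset n → Set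
  ProperNormal K S = IsSubgroup G S × S ⊆ K × ¬ (K ⊆ S) × NormalIn S K

  properNormal? : ∀ K → Decidable (ProperNormal K)
  properNormal? K S = isSubgroup? S ×-dec (S ⊆? K) ×-dec ¬? (K ⊆? S) ×-dec normalIn? S K

  module MaximalNormal (K N : Sub G) (N-proper : ProperNormal (proj₁ K) (proj₁ N))
    (N-maximal : ∀ U → ProperNormal (proj₁ K) U → proj₁ N ⊆ U → U ⊆ proj₁ N)
    (M : Sub G) (M-coatom : CoatomOf G N K M) (M-modular : LeftModularIn G N K M) where

    private
      N⊆K = proj₁ (proj₂ N-proper)
      N-normal = proj₂ (proj₂ (proj₂ N-proper))
      N⊆M = proj₁ (proj₁ M-coatom)

    open Quotient G K N (λ k∈ h∈ → N-normal _ k∈ _ h∈)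
    private module Q = GroupTheory quotient

    preimage-proper : ∀ (J : Sub quotient) → (∀ g {a} → a Q.∈ˢ J → Q.conj g a Q.∈ˢ J) →
      ¬ (proj₁ K ⊆ proj₁ (preimage J)) → ProperNormal (proj₁ K) (proj₁ (preimage J))
    preimage-proper J J-normal K⊈J = proj₂ (preimage J) , (λ x∈ → proj₁ (preimage⁻ J x∈)) , K⊈J
      , λ k k∈ h h∈ → let h∈K , πh∈ = preimage⁻ J h∈ in
          preimage⁺ J (conj∈ K k∈ h∈K) (subst (Q._∈ˢ J) (π-conj k∈ h∈K) (J-normal (π k∈) πh∈))

    -- The preimage of a normal subgroup is normal in `K` and contains `N`; if it is proper,
    -- maximality makes it `N`, whose image is trivial.
    quotient-simple : Maximality.Simple quotient
    quotient-simple J J-normal = decide (proj₁ K ⊆? proj₁ (preimage J))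
      where
      decide : Dec (proj₁ K ⊆ proj₁ (preimage J)) → (∀ {a} → a Q.∈ˢ J → a ≡ Q.e) ⊎ (∀ a → a Q.∈ˢ J)
      decide (yes K⊆J) = inj₂ λ i → rep∈preimage⁻ J (K⊆J (rep∈K i))
      decide (no K⊈J)  = inj₁ λ {i} i∈J → trans (sym (π-rep i)) (π-cong (rep∈K i) (e∈ K)
        (subst (_∈ˢ N) (sym (idʳ _)) (inv∈ N
          (N-maximal _ (preimage-proper J J-normal K⊈J) (N⊆preimage N⊆K J) (rep∈preimage J i∈J)))))

    outside-M : ∃ λ z → z ∈ˢ K × z ∉ proj₁ M
    outside-M = ⊈⇒∃∉ λ K⊆M → proj₂ (proj₁ (proj₂ M-coatom)) (⊆-antisym (proj₂ (proj₁ M-coatom)) K⊆M)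

    quotient-commutative : ∀ a b → a Q.· b ≡ b Q.· a
    quotient-commutative = SimpleGroup.commutative quotient (image N⊆K M N⊆M)
      (image-meetsMaximally N⊆K M N⊆M (leftModular-meetsMaximally {N} {K} {M} M-coatom M-modular))
      quotient-simple {π (proj₁ (proj₂ outside-M))}
      (λ πz∈ → proj₂ (proj₂ outside-M) (~-∈ N⊆K M N⊆M (rep-π _) (∈⟪⟫⁻ (image? N⊆K M N⊆M) πz∈)))

    comm∈N : ∀ {a b} → a ∈ˢ K → b ∈ˢ K → comm a b ∈ˢ N
    comm∈N {a} {b} a∈ b∈ = subst (_∈ˢ N)
      -- Cosets are compared by `inv x · y`, so commutativity is applied to the classes of the
      -- inverses: this gives exactly the form of `comm a b`.
      (solve 2 (λ a b → (b ⁻¹ ⊗ a ⁻¹) ⁻¹ ⊗ (a ⁻¹ ⊗ b ⁻¹) ⊜ commᵉ a b) refl a b)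
      (π-reflects (·∈ K (inv∈ K b∈) (inv∈ K a∈)) (·∈ K (inv∈ K a∈) (inv∈ K b∈))
        (trans (sym (π-· (inv∈ K b∈) (inv∈ K a∈)))
          (trans (quotient-commutative _ _) (π-· (inv∈ K a∈) (inv∈ K b∈)))))

    abelianStep : NormalAbelianStep G (proj₁ N) (proj₁ K)
    abelianStep = N⊆K , (λ k∈ h∈ → N-normal _ k∈ _ h∈) , comm∈N

  maximalNormal : ∀ K → IsSubgroup G K → ¬ (K ⊆ ⁅ e ⁆) →
    ∃ λ N → ProperNormal K N × (∀ U → ProperNormal K U → N ⊆ U → U ⊆ N)
  maximalNormal K K-sub K⊈e =
    let N , N-proper , _ , N-maximal = maximal (properNormal? K) ⁅ e ⁆
          ( ⁅e⁆-isSubgroup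
          , (λ x∈ → subst (_∈ K) (sym (x∈⁅y⁆⇒x≡y e x∈)) (proj₁ K-sub))
          , K⊈e
          , λ k _ h h∈ → subst (_∈ ⁅ e ⁆) (sym (trans (cong (conj k) (x∈⁅y⁆⇒x≡y e h∈)) (Maximality.conj-e G k))) (x∈⁅x⁆ e))
    in N , N-proper , N-maximal

  comodernistic⇒solvable : Comodernistic G → Solvable G
  comodernistic⇒solvable comodernistic = series⇒solvable (descend ⊤ (⊂-wellFounded ⊤) ⊤-isSubgroup top)
    where
    -- Each round adds a maximal proper normal subgroup of the current `K` at the bottom of the
    -- series. It is strictly smaller than `K`, so the trivial group is reached.
    descend : ∀ K → Acc _⊂_ K → IsSubgroup G K → Series G K → Series G ⁅ e ⁆
    descend K (acc rec) K-sub series = decide (K ⊆? ⁅ e ⁆)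
      where
      decide : Dec (K ⊆ ⁅ e ⁆) → Series G ⁅ e ⁆
      decide (yes K⊆e) =
        subst (Series G) (⊆-antisym K⊆e λ x∈ → subst (_∈ K) (sym (x∈⁅y⁆⇒x≡y e x∈)) (proj₁ K-sub)) series
      decide (no K⊈e) =
        let N , N-proper@(N-sub , N⊆K , K⊈N , _) , N-maximal = maximalNormal K K-sub K⊈e
            M , M-coatom , M-modular = comodernistic (N , N-sub) (K , K-sub)
              (N⊆K , λ eq → K⊈N λ {a} a∈K → subst (a ∈_) (sym eq) a∈K)
        in descend N (rec (N⊆K , ⊈⇒∃∉ K⊈N)) N-sub (step N-sub
             (MaximalNormal.abelianStep (K , K-sub) (N , N-sub) N-proper N-maximal M M-coatom M-modular) series)

-- Derived series, products of subgroups, and left-modular coatoms in solvable groups.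

module SolvableGroup {n : ℕ} (G : FinGroup n) where
  open GroupTheory G
  open Maximality G using (conjugate; conjugate?; conj-conj)

  ContainsComm : Sub G → Subset n → Set
  ContainsComm H T = ∀ a → a ∈ˢ H → ∀ b → b ∈ˢ H → comm a b ∈ T

  -- The derived subgroup as the intersection of all subgroups containing the commutators. The
  -- quantification over subsets is decided by searching for a counterexample.
  derived? : ∀ H → Decidable (λ x → ∀ T → IsSubgroup G T → ContainsComm H T → x ∈ T)
  derived? H x = map′
    (λ ∄ T T-sub T-comm → decidable-stable (x ∈? T) λ x∉T → ∄ (T , T-sub , T-comm , x∉T))
    (λ x∈ (T , T-sub , T-comm , x∉T) → x∉T (x∈ T T-sub T-comm))
    (¬? (anySubset? λ T → isSubgroup? T
      ×-dec (all? λ a → (a ∈ˢ? H) →-dec all? λ b → (b ∈ˢ? H) →-dec (comm a b ∈? T))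
      ×-dec ¬? (x ∈? T)))

  derived : Sub G → Sub G
  derived H = subgroup (derived? H) (λ T T-sub _ → e∈ (T , T-sub))
    λ a∈ b∈ T T-sub T-comm → ·∈ (T , T-sub) (a∈ T T-sub T-comm) (b∈ T T-sub T-comm)

  comm∈derived : ∀ H {a b} → a ∈ˢ H → b ∈ˢ H → comm a b ∈ˢ derived H
  comm∈derived H a∈ b∈ = ∈⟪⟫⁺ (derived? H) λ T _ T-comm → T-comm _ a∈ _ b∈

  derived-least : ∀ H (T : Sub G) → ContainsComm H (proj₁ T) → proj₁ (derived H) ⊆ proj₁ T
  derived-least H T T-comm x∈ = ∈⟪⟫⁻ (derived? H) x∈ (proj₁ T) (proj₂ T) T-comm

  derived-⊆ : ∀ H → proj₁ (derived H) ⊆ proj₁ H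
  derived-⊆ H {x} = derived-least H H (λ a a∈ b b∈ → comm∈ H a∈ b∈) {x}

  -- The conjugate of `derived H` by `inv k` contains all commutators of `H`, because `k` normalizes
  -- `H`; by minimality it contains `derived H`.
  derived-normal : ∀ (H V : Sub G) → NormalIn G (proj₁ H) (proj₁ V) → NormalIn G (proj₁ (derived H)) (proj₁ V)
  derived-normal H V H-normal k k∈ x x∈ = subst (λ g → conj g x ∈ˢ derived H) (inv-inv k)
    (∈⟪⟫⁻ (conjugate? (inv k) (derived H)) (derived-least H (conjugate (inv k) (derived H))
      (λ a a∈ b b∈ → ∈⟪⟫⁺ (conjugate? (inv k) (derived H)) (subst (_∈ˢ derived H)
        (solve 3 (λ k a b → commᵉ (conjᵉ k a) (conjᵉ k b) ⊜ conjᵉ (k ⁻¹ ⁻¹) (commᵉ a b)) refl k a b)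
        (comm∈derived H (H-normal k k∈ a a∈) (H-normal k k∈ b b∈)))) x∈))

  derivedSeries : Sub G → ℕ → Sub G
  derivedSeries V zero    = V
  derivedSeries V (suc i) = derived (derivedSeries V i)

  derivedSeries-⊆ : ∀ V i → proj₁ (derivedSeries V i) ⊆ proj₁ V
  derivedSeries-⊆ V zero    x∈ = x∈
  derivedSeries-⊆ V (suc i) x∈ = derivedSeries-⊆ V i (derived-⊆ (derivedSeries V i) x∈)

  derivedSeries-normal : ∀ V i → NormalIn G (proj₁ (derivedSeries V i)) (proj₁ V)
  derivedSeries-normal V zero    k k∈ h h∈ = conj∈ V k∈ h∈
  derivedSeries-normal V (suc i) = derived-normal (derivedSeries V i) V (derivedSeries-normal V i)

  -- Each step of the series costs one derivation: a subgroup inside `K` has its derived subgroup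
  -- inside `H`.
  series⇒derivedSeries : ∀ V {H} → Series G H → ∃ λ i → proj₁ (derivedSeries V i) ⊆ H
  series⇒derivedSeries V top = 0 , λ _ → ∈⊤
  series⇒derivedSeries V (step {H} H-sub (_ , _ , comm∈H) series) =
    let i , D⊆K = series⇒derivedSeries V series
    in suc i , derived-least (derivedSeries V i) (H , H-sub) λ a a∈ b b∈ → comm∈H (D⊆K a∈) (D⊆K b∈)

  product? : ∀ (S T : Sub G) → Decidable (λ x → ∃ λ y → y ∈ˢ S × (inv y · x) ∈ˢ T)
  product? S T x = any? λ y → (y ∈ˢ? S) ×-dec ((inv y · x) ∈ˢ? T)

  module _ (S T : Sub G) (T-normal : NormalIn G (proj₁ T) (proj₁ S)) where

    product : Sub G
    product = subgroup (product? S T) (e , e∈ S , subst (_∈ˢ T) (sym (invˡ e)) (e∈ T))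
      λ { {a} {b} (y , y∈ , a∈) (z , z∈ , b∈) → y · z , ·∈ S y∈ z∈ , subst (_∈ˢ T)
        (solve 4 (λ a b y z → conjᵉ (z ⁻¹) (y ⁻¹ ⊗ a) ⊗ (z ⁻¹ ⊗ b) ⊜ (y ⊗ z) ⁻¹ ⊗ (a ⊗ b)) refl a b y z)
        (·∈ T (T-normal (inv z) (inv∈ S z∈) _ a∈) b∈) }

    left-⊆-product : proj₁ S ⊆ proj₁ product
    left-⊆-product {x} x∈ = ∈⟪⟫⁺ (product? S T) (x , x∈ , subst (_∈ˢ T) (sym (invˡ x)) (e∈ T))

    right-⊆-product : proj₁ T ⊆ proj₁ product
    right-⊆-product {x} x∈ = ∈⟪⟫⁺ (product? S T) (e , e∈ S , subst (_∈ˢ T) (solve 1 (λ x → x ⊜ one ⁻¹ ⊗ x) refl x) x∈)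

    product-⊆ : ∀ (V : Sub G) → proj₁ S ⊆ proj₁ V → proj₁ T ⊆ proj₁ V → proj₁ product ⊆ proj₁ V
    product-⊆ V S⊆V T⊆V {x} x∈ = let y , y∈ , yx∈ = ∈⟪⟫⁻ (product? S T) x∈ in
      subst (_∈ˢ V) (cancelˡ′ y x) (·∈ V (S⊆V y∈) (T⊆V yx∈))

  last-true : ∀ {P : Pred ℕ 0ℓ} → Decidable P → P 0 → ∀ j → ¬ P j → ∃ λ i → P i × ¬ P (suc i)
  last-true P? p0 zero    ¬pj = contradiction p0 ¬pj
  last-true P? p0 (suc j) ¬pj with P? j
  ... | yes pj = j , pj , ¬pj
  ... | no ¬pj′ = last-true P? p0 j ¬pj′

  Proper : Sub G → Subset n → Set
  Proper V S = IsSubgroup G S × S ⊆ proj₁ V × ¬ (proj₁ V ⊆ S)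

  proper? : ∀ V → Decidable (Proper V)
  proper? V S = isSubgroup? S ×-dec (S ⊆? proj₁ V) ×-dec ¬? (proj₁ V ⊆? S)

  maximalSubgroup-coatom : ∀ u v m → proj₁ u ⊆ proj₁ m → Proper v (proj₁ m) →
    (∀ U → Proper v U → proj₁ m ⊆ U → U ⊆ proj₁ m) → CoatomOf G u v m
  maximalSubgroup-coatom u v m u⊆m (_ , m⊆v , v⊈m) m-maximal = (u⊆m , m⊆v)
    , (m⊆v , λ eq → v⊈m λ {a} a∈v → subst (a ∈_) (sym eq) a∈v)
    , λ k m⊆k k⊆v → between k m⊆k k⊆v (proj₁ v ⊆? proj₁ k)
    where
    between : ∀ (k : Sub G) → proj₁ m ⊆ proj₁ k → proj₁ k ⊆ proj₁ v → Dec (proj₁ v ⊆ proj₁ k) →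
      (proj₁ k ≡ proj₁ m) ⊎ (proj₁ k ≡ proj₁ v)
    between k m⊆k k⊆v (yes v⊆k) = inj₂ (⊆-antisym k⊆v v⊆k)
    between k m⊆k k⊆v (no v⊈k)  = inj₁ (⊆-antisym (m-maximal (proj₁ k) (proj₂ k , k⊆v , v⊈k) m⊆k) m⊆k)

  module _ {u v m A : Sub G} (m-coatom : CoatomOf G u v m)
    (A-normal : NormalIn G (proj₁ A) (proj₁ v))
    (v⊆uA : ∀ {x} → x ∈ˢ v → ∃ λ y → y ∈ˢ u × (inv y · x) ∈ˢ A)
    (comm∈m : ∀ {a b} → a ∈ˢ A → b ∈ˢ A → comm a b ∈ˢ m) where

    private
      u⊆m = proj₁ (proj₁ m-coatom)
      m⊆v = proj₂ (proj₁ m-coatom)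

      K : Sub G
      K = intersection G A m

      K⁺ : ∀ {a} → a ∈ˢ A → a ∈ˢ m → a ∈ˢ K
      K⁺ = intersection⁺ G A m

      -- Write `g` as `y` times an element of `A` with `y` in `u`. The factor from `A` preserves
      -- membership in `m` because commutators of `A` lie in `m`; the factor `y` does because it
      -- lies in `m` itself.
      K-normal : NormalIn G (proj₁ K) (proj₁ v)
      K-normal g g∈ k k∈ =
        let y , y∈u , yg∈A = v⊆uA g∈
            k∈A , k∈m = intersection⁻ G A m k∈
        in K⁺ (A-normal g g∈ k k∈A)
          (subst (_∈ˢ m) (trans (sym (conj-conj y (inv y · g) k)) (cong (λ h → conj h k) (cancelˡ′ y g)))
            (conj∈ m (u⊆m y∈u) (subst (_∈ˢ m)
              (solve 2 (λ a k → commᵉ a k ⊗ k ⊜ conjᵉ a k) refl (inv y · g) k)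
              (·∈ m (comm∈m yg∈A k∈A) k∈m))))

    -- If `x` is below `m`, so is the join, and both sides are the meet of `m` and `y` joined with
    -- `x`. Otherwise the join is `v`, which equals `xK`; an element of `y` is then some `h` in `x`
    -- times an element of `K`, and that second factor lies in both `m` and `y`.
    coatom-leftModular : LeftModularIn G u v m
    coatom-leftModular x y (u⊆x , x⊆v) (_ , y⊆v) (x⊆y , _) xm lhs my rhs
      (x⊆xm , m⊆xm , xm-least) (lhs⊆xm , lhs⊆y , lhs-greatest) (my⊆m , my⊆y , my-greatest) (x⊆rhs , my⊆rhs , rhs-least) =
      ⊆-antisym (lhs⊆rhs (proj₁ x ⊆? proj₁ m))
        (rhs-least lhs (lhs-greatest x x⊆xm x⊆y) (lhs-greatest my (λ a∈ → m⊆xm (my⊆m a∈)) my⊆y))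
      where
      xK : Sub G
      xK = product x K λ g g∈ → K-normal g (x⊆v g∈)

      -- Dedekind's rule: in a decomposition of an element of `m` along `u` and `A`, the factor from
      -- `A` lies in `m` because `u` does.
      m⊆xK : proj₁ m ⊆ proj₁ xK
      m⊆xK {g} g∈m = let y , y∈u , yg∈A = v⊆uA (m⊆v g∈m) in
        ∈⟪⟫⁺ (product? x K) (y , u⊆x y∈u , K⁺ yg∈A (·∈ m (inv∈ m (u⊆m y∈u)) g∈m))

      lhs⊆rhs : Dec (proj₁ x ⊆ proj₁ m) → proj₁ lhs ⊆ proj₁ rhs
      lhs⊆rhs (yes x⊆m) a∈ = my⊆rhs (my-greatest lhs (λ a∈ → xm-least m x⊆m (λ b∈ → b∈) (lhs⊆xm a∈)) lhs⊆y a∈)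
      lhs⊆rhs (no x⊈m) {g} g∈lhs =
        let v⊆xK = proj₂ (proj₂ (coatom-join G {u} {v} {m} {x} m-coatom x⊆v x⊈m)) xK
                     (left-⊆-product x K λ g g∈ → K-normal g (x⊆v g∈)) m⊆xK
            g∈y = lhs⊆y g∈lhs
            h , h∈x , hg∈K = ∈⟪⟫⁻ (product? x K) (v⊆xK (y⊆v g∈y))
            hg∈y = ·∈ y (inv∈ y (x⊆y h∈x)) g∈y
            hg∈m = proj₂ (intersection⁻ G A m hg∈K)
            hg∈my = my-greatest (intersection G m y) (λ a∈ → proj₁ (intersection⁻ G m y a∈)) (λ a∈ → proj₂ (intersection⁻ G m y a∈))
                      (intersection⁺ G m y hg∈m hg∈y)
        in subst (_∈ˢ rhs) (cancelˡ′ h g) (·∈ rhs (x⊆rhs h∈x) (my⊆rhs hg∈my))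

  modularCoatom : ∀ u v i → proj₁ u ⊆ proj₁ v →
    (∀ {x} → x ∈ˢ v → ∃ λ y → y ∈ˢ u × (inv y · x) ∈ˢ derivedSeries v i) →
    ¬ (∀ x → x ∈ˢ v → ∃ λ y → y ∈ˢ u × (inv y · x) ∈ˢ derivedSeries v (suc i)) →
    Σ (Sub G) λ m → CoatomOf G u v m × LeftModularIn G u v m
  modularCoatom u v i u⊆v v⊆uA v⊈uB =
    let m , m-proper , uB⊆m , m-maximal = maximal (proper? v) (proj₁ uB)
          (proj₂ uB , product-⊆ u B B-normal v u⊆v (derivedSeries-⊆ v (suc i))
          , λ v⊆uB → v⊈uB λ x x∈v → ∈⟪⟫⁻ (product? u B) (v⊆uB x∈v))
    in coatom (m , proj₁ m-proper) m-proper uB⊆m m-maximal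
    where
    A B : Sub G
    A = derivedSeries v i
    B = derivedSeries v (suc i)

    B-normal : NormalIn G (proj₁ B) (proj₁ u)
    B-normal k k∈ = derivedSeries-normal v (suc i) k (u⊆v k∈)

    uB : Sub G
    uB = product u B B-normal

    coatom : ∀ m → Proper v (proj₁ m) → proj₁ uB ⊆ proj₁ m →
      (∀ U → Proper v U → proj₁ m ⊆ U → U ⊆ proj₁ m) →
      Σ (Sub G) λ m → CoatomOf G u v m × LeftModularIn G u v m
    coatom m m-proper uB⊆m m-maximal = m , m-coatom
      , coatom-leftModular {u} {v} {m} {A} m-coatom (derivedSeries-normal v i) v⊆uA
          λ a∈ b∈ → uB⊆m (right-⊆-product u B B-normal (comm∈derived A a∈ b∈))
      where
      m-coatom : CoatomOf G u v m
      m-coatom = maximalSubgroup-coatom u v m (λ x∈ → uB⊆m (left-⊆-product u B B-normal x∈)) m-proper m-maximal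

  solvable⇒comodernistic : Solvable G → Comodernistic G
  solvable⇒comodernistic solvable u v (u⊆v , u≢v) =
    let j , Dj⊆e = series⇒derivedSeries v (solvable⇒series G solvable)
        -- The property holds at 0, where the derived series is `v` itself, and fails at `j`, where
        -- a trivial term would force `v` into `u`.
        i , v⊆uA , v⊈uB = last-true (λ i → all? λ x → (x ∈ˢ? v) →-dec product? u (derivedSeries v i) x)
          (λ x x∈v → e , e∈ u , subst (_∈ˢ v) (solve 1 (λ x → x ⊜ one ⁻¹ ⊗ x) refl x) x∈v)
          j (λ v⊆uDj → u≢v (⊆-antisym u⊆v λ {x} x∈v → let y , y∈u , yx∈Dj = v⊆uDj x x∈v in
              subst (_∈ˢ u) (trans (sym (idʳ y)) (trans (cong (y ·_) (sym (x∈⁅y⁆⇒x≡y e (Dj⊆e yx∈Dj)))) (cancelˡ′ y x))) y∈u))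
    in modularCoatom u v i u⊆v (λ {x} → v⊆uA x) v⊈uB

theorem1p7 : ∀ (n : ℕ) (G : FinGroup n) → Solvable G ⇔ Comodernistic G
theorem1p7 n G = mk⇔ (SolvableGroup.solvable⇒comodernistic G) (comodernistic⇒solvable G)
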